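{- Let $m\ge 2$ and $n\ge 1$ be integers. Then, as formal power series in $q,z_1,\ldots,z_{m-1}$, $$\sum_{\mu\in\mathcal{L}_{m\searrow}^n} z_1^{s_1(\mu)}\cdots z_{m-1}^{s_{m-1}(\mu)}q^{|\mu|}=\sum_{\lambda\in\mathcal{O}_{m\searrow}^n} z_1^{\ell_1(\lambda)}\cdots z_{m-1}^{\ell_{m-1}(\lambda)}q^{|\lambda|},$$ where $\mathcal{L}_{m\searrow}^n$ and $\mathcal{O}_{m\searrow}^n$ are the sets of partitions defined in the context.
   Context: A partition $\lambda=(\lambda_1,\lambda_2,\ldots)$ is a nonincreasing sequence of nonnegative integers with finitely many nonzero terms (zeros are appended as needed); $|\lambda|=\sum_i\lambda_i$ is its weight and $l(\lambda)$ is the number of nonzero parts. For $1\le i\le m$, let $s_i(\lambda)=\lambda_i-\lambda_{i+1}+\lambda_{m+i}-\lambda_{m+i+1}+\lambda_{2m+i}-\lambda_{2m+i+1}+\cdots$. For $1\le i\le m$, let $\ell_i(\lambda)=\#\{j:\lambda_j>0,\ \lambda_j\equiv i \pmod m\}$. $\mathcal{O}_{m\searrow}^n$ is the set of partitions $\lambda$ such that no nonzero part is divisible by $m$, the least nonnegative residues modulo $m$ of the nonzero parts $\lambda_1,\lambda_2,\ldots$ (taken in order) form a nonincreasing sequence, and $\lambda_1<nm$. $\mathcal{D}_m$ is the set of partitions in which each nonzero part appears at most $m-1$ times. For $\lambda\in\mathcal{D}_m$ and each $i$ with $0\le i\le\lfloor (l(\lambda)-1)/m\rfloor$, the block $\lambda_{im+1}\ge\cdots\ge\lambda_{im+m}$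 satisfies $\lambda_{im+1}>\lambda_{im+m}$; define $\mathrm{fb}_i$ as the largest $j\in\{1,\dots,m\}$ with $\lambda_{im+j}=\lambda_{im+1}$ and $\mathrm{lb}_i$ as the largest $k\in\{1,\dots,m\}$ with $\lambda_{im+k}>\lambda_{im+m}$ (so $\lambda_{im+1}=\cdots=\lambda_{im+j}>\lambda_{im+j+1}\ge\cdots\ge\lambda_{im+k}>\lambda_{im+k+1}=\cdots=\lambda_{im+m}$). $\mathcal{L}_{m\searrow}^n$ is the set of $\lambda\in\mathcal{D}_m$ with $l(\lambda)\le\lfloor (n+1)/2\rfloor(m-2)+n$ such that: (1) for all $0\le i<\lfloor (l(\lambda)-1)/m\rfloor$, $\mathrm{lb}_i\le \mathrm{fb}_{i+1}$; and (2) if $n=2k$, then $\frac{\lambda_1}{n}\ge\frac{\lambda_m}{n-1}\ge\frac{\lambda_{m+1}}{n-2}\ge\frac{\lambda_{2m}}{n-3}\ge\cdots\ge\frac{\lambda_{(k-1)m+1}}{2}\ge\frac{\lambda_{km}}{1}$, and if $n=2k+1$, then $\frac{\lambda_1}{n}\ge\frac{\lambda_m}{n-1}\ge\frac{\lambda_{m+1}}{n-2}\ge\frac{\lambda_{2m}}{n-3}\ge\cdots\ge\frac{\lambda_{km+1}}{1}\ge\frac{\lambda_{km+m}}{0}$, with the convention that a fraction $p/0$ forces $p=0$. -}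

module Defs where

open import Data.Nat using (ℕ; zero; suc; _+_; _*_; _∸_; _≤ᵇ_; _<ᵇ_; _≡ᵇ_; NonZero)
open import Data.Nat.DivMod using (_%_; _/_)
open import Data.Bool using (Bool; true; false; _∧_; not; if_then_else_)
open import Data.List using (List; []; _∷_; length; map; upTo; applyUpTo; concatMap)
open import Data.Nat.ListAction using (sum)
open import Data.Vec using (Vec; tabulate)
import Data.Vec as V
open import Data.Fin using (Fin; toℕ)

-- A partition is represented by the list of its nonzero parts (λ₁ ≥ λ₂ ≥ … > 0).
-- part μ j = λ_j (1-indexed), with λ_j = 0 for j > l(μ) (zeros appended).
part : List ℕ → ℕ → ℕ
part []       _             = 0
part (x ∷ xs) zero          = 0   -- index 0 is never used
part (x ∷ xs) (suc zero)    = x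
part (x ∷ xs) (suc (suc j)) = part xs (suc j)

nonincr : List ℕ → Bool
nonincr []             = true
nonincr (x ∷ [])       = true
nonincr (x ∷ y ∷ ys)   = (y ≤ᵇ x) ∧ nonincr (y ∷ ys)

occ : ℕ → List ℕ → ℕ
occ x μ = sum (map (λ y → if x ≡ᵇ y then 1 else 0) μ)

allᵇ : {A : Set} → (A → Bool) → List A → Bool
allᵇ P []       = true
allᵇ P (x ∷ xs) = P x ∧ allᵇ P xs

countᵇ : {A : Set} → (A → Bool) → List A → ℕ
countᵇ P xs = sum (map (λ x → if P x then 1 else 0) xs)

lists : ℕ → ℕ → List (List ℕ)
lists zero    N = [] ∷ []
lists (suc L) N = [] ∷ concatMap (λ x → map (x ∷_) (lists L N)) (applyUpTo suc N)

partitionsOf : ℕ → List (List ℕ)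
partitionsOf N = Data.List.filterᵇ (λ μ → nonincr μ ∧ (sum μ ≡ᵇ N)) (lists N N)

-- s_i(λ) = Σ_{t ≥ 0} (λ_{tm+i} − λ_{tm+i+1}); terms vanish for tm+i > l(λ).
s : ℕ → ℕ → List ℕ → ℕ
s m i μ = sum (map (λ t → part μ (t * m + i) ∸ part μ (t * m + i + 1)) (upTo (suc (length μ))))

ℓ : (m : ℕ) .{{_ : NonZero m}} → ℕ → List ℕ → ℕ
ℓ m i μ = countᵇ (λ x → (x % m) ≡ᵇ i) μ

sVec : (m : ℕ) → List ℕ → Vec ℕ (m ∸ 1)
sVec m μ = tabulate (λ (i : Fin (m ∸ 1)) → s m (suc (toℕ i)) μ)

ℓVec : (m : ℕ) .{{_ : NonZero m}} → List ℕ → Vec ℕ (m ∸ 1)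
ℓVec m μ = tabulate (λ (i : Fin (m ∸ 1)) → ℓ m (suc (toℕ i)) μ)

eqVecᵇ : {k : ℕ} → Vec ℕ k → Vec ℕ k → Bool
eqVecᵇ V.[] V.[] = true
eqVecᵇ (x V.∷ xs) (y V.∷ ys) = (x ≡ᵇ y) ∧ eqVecᵇ xs ys

inO : (m : ℕ) .{{_ : NonZero m}} → ℕ → List ℕ → Bool
inO m n μ = allᵇ (λ x → not ((x % m) ≡ᵇ 0)) μ
          ∧ nonincr (map (λ x → x % m) μ)
          ∧ (part μ 1 <ᵇ n * m)

inD : ℕ → List ℕ → Bool
inD m μ = allᵇ (λ x → occ x μ ≤ᵇ (m ∸ 1)) μ

largestIn : (ℕ → Bool) → ℕ → ℕ
largestIn P zero    = 0
largestIn P (suc k) = if P (suc k) then suc k else largestIn P k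

fb : ℕ → List ℕ → ℕ → ℕ
fb m μ i = largestIn (λ j → part μ (i * m + j) ≡ᵇ part μ (i * m + 1)) m

lb : ℕ → List ℕ → ℕ → ℕ
lb m μ i = largestIn (λ j → part μ (i * m + m) <ᵇ part μ (i * m + j)) m

-- (1): lb_i ≤ fb_{i+1} for 0 ≤ i < ⌊(l(λ)−1)/m⌋  (empty range when l(λ) = 0)
cond1 : (m : ℕ) .{{_ : NonZero m}} → List ℕ → Bool
cond1 m μ = allᵇ (λ i → lb m μ i ≤ᵇ fb m μ (suc i)) (upTo ((length μ ∸ 1) / m))

-- index of the r-th term of the chain λ_1, λ_m, λ_{m+1}, λ_{2m}, λ_{2m+1}, …
pos : ℕ → ℕ → ℕ
pos m r = if (r % 2) ≡ᵇ 0 then (r / 2) * m + 1 else ((r + 1) / 2) * m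

-- number of "≥" steps in the chain: the r-th term has denominator n − r,
-- terms r = 0 … n−1 if n even, r = 0 … n if n odd.
chainLen : ℕ → ℕ
chainLen n = if (n % 2) ≡ᵇ 0 then n ∸ 1 else n

-- (2): λ_{pos r}/(n−r) ≥ λ_{pos (r+1)}/(n−r−1), written cross-multiplied
-- (n − r ≥ 1 always; when n−r−1 = 0 this forces λ_{pos(r+1)} = 0, the p/0 convention).
cond2 : ℕ → ℕ → List ℕ → Bool
cond2 m n μ = allᵇ (λ r → (part μ (pos m (suc r)) * (n ∸ r)) ≤ᵇ (part μ (pos m r) * (n ∸ suc r)))
                  (upTo (chainLen n))

inL : (m : ℕ) .{{_ : NonZero m}} → ℕ → List ℕ → Bool
inL m n μ = inD m μ
          ∧ (length μ ≤ᵇ (((n + 1) / 2) * (m ∸ 2) + n))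
          ∧ cond1 m μ
          ∧ cond2 m n μ

-- Coefficients of q^N z_1^{a_1} ⋯ z_{m-1}^{a_{m-1}} on both sides.

coeffL : (m : ℕ) .{{_ : NonZero m}} → ℕ → ℕ → Vec ℕ (m ∸ 1) → ℕ
coeffL m n N a = countᵇ (λ μ → inL m n μ ∧ eqVecᵇ (sVec m μ) a) (partitionsOf N)

coeffO : (m : ℕ) .{{_ : NonZero m}} → ℕ → ℕ → Vec ℕ (m ∸ 1) → ℕ
coeffO m n N a = countᵇ (λ λ' → inO m n λ' ∧ eqVecᵇ (ℓVec m λ') a) (partitionsOf N)

{-# OPTIONS --safe #-}
-- Cut μ ∈ L into blocks of m parts with first part X_i and last part Y_i. Condition (2) says that
-- (X_0, Y_0, X_1, Y_1, …) is a lecture hall partition, and condition (1) says that the columns j at which the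
-- blocks descend, with multiplicity, weakly increase from block to block. Hence μ is determined by its blocks
-- (D_i, Y_i), D_i = X_i − Y_i, and by the s_j: with A_j = s_1 + … + s_j,
-- μ_{im+j+1} = Y_i + (D_i ∸ (A_j ∸ (D_0 + … + D_{i−1}))). Similarly λ ∈ O is determined by the quotients of its
-- parts by m and by the ℓ_j, since the residues are sorted. In both cases the residues contribute Σ j s_j to the
-- weight, so what remains is a bijection between lecture hall partitions with Σ D_i = K and Σ Y_i = E and
-- multisets of K numbers below n with sum E.
--
-- To find the first block, insert the numbers in decreasing order: x is either kept, which adds (x + 1, x) to
-- (X_0, Y_0), or passed, which adds (1, 1) and hands x − 1 to the remaining blocks, whose level is n − 2. A nonzero
-- x is passed exactly when this preserves X_0 / n ≥ Y_0 / (n − 1). An insertion can be undone by inspecting only the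
-- counter (n − 1) X_0 − n Y_0 and the smallest passed number.
module Submission where

open import Defs
open import Data.Bool using (Bool; true; false; T; not; _∧_; if_then_else_)
open import Data.Bool.Properties using (T?; T-∧)
open import Data.Fin using (toℕ)
open import Data.List using (List; []; _∷_; _++_; length; map; foldr; replicate; reverse; zipWith; applyUpTo; upTo;
  filterᵇ; concatMap; cartesianProductWith)
open import Data.List.Membership.Propositional using (_∈_)
open import Data.List.Membership.Propositional.Properties
open import Data.List.Membership.Propositional.Properties.WithK using (unique∧set⇒bag)
open import Data.List.Properties using (map-∘; map-upTo; ∷-injective; length-map; length-++; length-replicate;
  length-reverse; reverse-involutive; unfold-reverse)
open import Data.List.Relation.Binary.BagAndSetEquality using (∼bag⇒↭)
open import Data.List.Relation.Binary.Permutation.Propositional using (↭-sym)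
open import Data.List.Relation.Binary.Permutation.Propositional.Properties using (↭-reverse; ↭-length; All-resp-↭)
open import Data.List.Relation.Unary.All using (All; []; _∷_)
import Data.List.Relation.Unary.All as All
import Data.List.Relation.Unary.All.Properties as All
open import Data.List.Relation.Unary.AllPairs using (AllPairs; []; _∷_)
import Data.List.Relation.Unary.AllPairs as AllPairs
import Data.List.Relation.Unary.AllPairs.Properties as AllPairs
open import Data.List.Relation.Unary.Any using (here; there)
open import Data.List.Relation.Unary.Unique.Propositional using (Unique)
import Data.List.Relation.Unary.Unique.Propositional.Properties as Unique
open import Data.Nat using (ℕ; zero; suc; pred; _+_; _*_; _∸_; _≤_; _<_; _≥_; z≤n; s≤s; s≤s⁻¹; _≤ᵇ_; _<ᵇ_; _≡ᵇ_; NonZero)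
open import Data.Nat.DivMod
open import Data.Nat.ListAction using (sum)
open import Data.Nat.ListAction.Properties using (sum-++; sum-↭)
open import Data.Nat.Properties
open import Data.Nat.Tactic.RingSolver using (solve-∀)
open import Data.Product using (_×_; _,_; proj₁; proj₂; ∃; ∃₂)
open import Data.Sum using (_⊎_; inj₁; inj₂; [_,_]′)
open import Data.Vec using (Vec; tabulate; toList)
import Data.Vec as Vec
open import Function using (_∘_; flip; _⇔_; mk⇔; Equivalence)
open import Relation.Binary.PropositionalEquality
open import Relation.Nullary using (¬_; yes; no; contradiction)

-- Insertion into the first block

-- (D , e , P) at level n + 1: the block has X − Y = D and Y = n * D − e, and P lists the passed parts,
-- already decreased by one. Lists of parts are ascending, so that foldr inserts the largest part first.
State : Set
State = ℕ × ℕ × List ℕ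

step : ℕ → ℕ → State → State
step n zero    (D , e     , P) = suc D , e + n , P
step n (suc x) (D , zero  , P) = suc D , n ∸ suc x , P
step n (suc x) (D , suc e , P) = D , e , x ∷ P

peel : ℕ → List ℕ → State
peel n = foldr (step n) (0 , 0 , [])

-- A kept x > 0 is preceded by counter 0 and leaves n - x; a kept 0 raises the counter by n. Hence
-- `n ∸ e` is the kept part and `e ∸ n` the earlier counter in both cases. The test `suc x + e < n`
-- tells whether the last insertion was a pass.
unpeel : ℕ → ℕ → ℕ → List ℕ → List ℕ
unpeel n zero    e P  = []
unpeel n (suc D) e [] = (n ∸ e) ∷ unpeel n D (e ∸ n) []
unpeel n (suc D) e (x ∷ P) =
  if suc x + e <ᵇ n then suc x ∷ unpeel n (suc D) (suc e) P else (n ∸ e) ∷ unpeel n D (e ∸ n) (x ∷ P)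

unpeel-pass : ∀ {n x e} D P → suc x + e < n →
  unpeel n (suc D) e (x ∷ P) ≡ suc x ∷ unpeel n (suc D) (suc e) P
unpeel-pass {n} {x} {e} D P h with suc x + e <ᵇ n | <⇒<ᵇ h
... | true | _ = refl

unpeel-keep : ∀ {n x e} D P → n ≤ suc x + e →
  unpeel n (suc D) e (x ∷ P) ≡ (n ∸ e) ∷ unpeel n D (e ∸ n) (x ∷ P)
unpeel-keep {n} {x} {e} D P h with suc x + e <ᵇ n | <ᵇ⇒< (suc x + e) n
... | true  | f = contradiction (<-≤-trans (f _) h) (<-irrefl refl)
... | false | _ = refl

Asc : List ℕ → Set
Asc = AllPairs _≤_

record Peeled (n : ℕ) (xs : List ℕ) (D e : ℕ) (P : List ℕ) : Set where
  field
    -- As Y = n * D - e, this says sum xs = Y + sum P without subtraction.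
    weight  : sum xs + e ≡ n * D + sum P
    size    : length xs ≡ D + length P
    counter : e ≤ n * D
    -- Any part inserted next that is passed will be recognised as such by unpeel.
    room    : ∀ x → All (x ≤_) xs → 1 ≤ x → x ≤ n → x + e ≤ n
    above   : ∀ x → All (x ≤_) xs → All (λ p → x ≤ suc p) P
    sorted  : Asc P
    bounded : All (_< pred n) P

open Peeled

-- For `room`: after a kept 0 no positive part can follow, after a kept x > 0 the counter is n - x
-- and later parts are at most x, and a pass only lowers the counter.
step-peeled : ∀ {n x xs} D e P → x ≤ n → All (x ≤_) xs → Peeled n xs D e P →
  let (D′ , e′ , P′) = step n x (D , e , P) in Peeled n (x ∷ xs) D′ e′ P′
step-peeled {n} {zero} {xs} D e P x≤n x≤xs I = record
  { weight  = trans (sym (+-assoc (sum xs) e n))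
                (trans (cong (_+ n) (weight I)) (eq n D (sum P)))
  ; size    = cong suc (size I)
  ; counter = subst (e + n ≤_) (trans (+-comm (n * D) n) (sym (*-suc n D))) (+-monoˡ-≤ n (counter I))
  ; room    = λ { x (x≤0 ∷ _) 1≤x _ → contradiction (≤-trans 1≤x x≤0) (λ ()) }
  ; above   = λ { x (_ ∷ h) → above I x h }
  ; sorted  = sorted I ; bounded = bounded I }
  where eq : ∀ n D s → n * D + s + n ≡ n * suc D + s
        eq = solve-∀
step-peeled {n} {suc x} {xs} D zero P x≤n x≤xs I = record
  { weight  = begin
      suc x + sum xs + (n ∸ suc x)   ≡⟨ eq (suc x) (sum xs) (n ∸ suc x) ⟩
      (suc x + (n ∸ suc x)) + (sum xs + 0) ≡⟨ cong₂ _+_ (m+[n∸m]≡n x≤n) (weight I) ⟩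
      n + (n * D + sum P)  ≡⟨ eq′ n D (sum P) ⟩
      n * suc D + sum P ∎
  ; size    = cong suc (size I)
  ; counter = ≤-trans (m∸n≤m n (suc x)) (≤-trans (m≤m+n n (n * D)) (≤-reflexive (sym (*-suc n D))))
  ; room    = λ { y (y≤ ∷ _) _ _ → ≤-trans (+-monoˡ-≤ (n ∸ suc x) y≤) (≤-reflexive (m+[n∸m]≡n x≤n)) }
  ; above   = λ { y (_ ∷ h) → above I y h }
  ; sorted  = sorted I ; bounded = bounded I }
  where open ≡-Reasoning
        eq : ∀ a b c → a + b + c ≡ (a + c) + (b + 0)
        eq = solve-∀
        eq′ : ∀ n D s → n + (n * D + s) ≡ n * suc D + s
        eq′ = solve-∀
step-peeled {n} {suc x} {xs} D (suc e) P x≤n x≤xs I = record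
  { weight  = begin
      suc x + sum xs + e  ≡⟨ eq x (sum xs) e ⟩
      x + (sum xs + suc e) ≡⟨ cong (x +_) (weight I) ⟩
      x + (n * D + sum P) ≡⟨ eq′ x (n * D) (sum P) ⟩
      n * D + (x + sum P) ∎
  ; size    = trans (cong suc (size I)) (sym (+-suc D (length P)))
  ; counter = ≤-trans (n≤1+n e) (counter I)
  ; room    = λ { y (y≤ ∷ h) 1≤y y≤n → ≤-trans (+-monoʳ-≤ y (n≤1+n e)) (room I y h 1≤y y≤n) }
  ; above   = λ { y (y≤ ∷ h) → y≤ ∷ above I y h }
  ; sorted  = All.map s≤s⁻¹ (above I (suc x) x≤xs) ∷ sorted I
  ; bounded = below (room I (suc x) x≤xs (s≤s z≤n) x≤n) ∷ bounded I }
  where open ≡-Reasoning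
        eq : ∀ x s e → suc x + s + e ≡ x + (s + suc e)
        eq = solve-∀
        eq′ : ∀ a b c → a + (b + c) ≡ b + (a + c)
        eq′ = solve-∀
        below : ∀ {n x e} → suc x + suc e ≤ n → x < pred n
        below {suc n} {x} {e} (s≤s h) = ≤-trans (s≤s (m≤m+n x e)) (≤-trans (≤-reflexive (sym (+-suc x e))) h)

peel-peeled : ∀ {n xs} → Asc xs → All (_≤ n) xs →
  let (D , e , P) = peel n xs in Peeled n xs D e P
peel-peeled {n} [] [] = record
  { weight = trans (sym (*-zeroʳ n)) (sym (+-identityʳ (n * 0))) ; size = refl ; counter = z≤n
  ; room = λ x _ _ x≤n → ≤-trans (≤-reflexive (+-identityʳ x)) x≤n
  ; above = λ _ _ → [] ; sorted = [] ; bounded = [] }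
peel-peeled {n} {x ∷ xs} (x≤ ∷ s) (b ∷ bs) =
  step-peeled _ _ _ b x≤ (peel-peeled s bs)

-- After a pass, `room` gives the strict inequality that is tested. After keeping x the counter is
-- at least n - x, and by `above` every passed part was at least x before its decrease, so the test
-- fails.
unpeel-step : ∀ {n x xs} D e P → x ≤ n → All (x ≤_) xs → Peeled n xs D e P →
  let (D′ , e′ , P′) = step n x (D , e , P) in unpeel n D′ e′ P′ ≡ x ∷ unpeel n D e P
unpeel-step {n} {zero} D e [] x≤n x≤ I =
  cong₂ _∷_ (m≤n⇒m∸n≡0 (m≤n+m n e)) (cong (λ z → unpeel n D z []) (m+n∸n≡m e n))
unpeel-step {n} {zero} D e (p ∷ P) x≤n x≤ I =
  trans (unpeel-keep D P (≤-trans (m≤n+m n e) (m≤n+m (e + n) (suc p))))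
    (cong₂ _∷_ (m≤n⇒m∸n≡0 (m≤n+m n e)) (cong (λ z → unpeel n D z (p ∷ P)) (m+n∸n≡m e n)))
unpeel-step {n} {suc x} D zero [] x≤n x≤ I =
  cong₂ _∷_ (m∸[m∸n]≡n x≤n) (cong (λ z → unpeel n D z []) (m≤n⇒m∸n≡0 (m∸n≤m n (suc x))))
unpeel-step {n} {suc x} D zero (p ∷ P) x≤n x≤ I =
  trans (unpeel-keep D P (≤-trans (≤-reflexive (sym (m+[n∸m]≡n x≤n)))
                           (+-monoˡ-≤ (n ∸ suc x) (All.head (above I (suc x) x≤)))))
    (cong₂ _∷_ (m∸[m∸n]≡n x≤n) (cong (λ z → unpeel n D z (p ∷ P)) (m≤n⇒m∸n≡0 (m∸n≤m n (suc x)))))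
unpeel-step {n} {suc x} zero (suc e) P x≤n x≤ I =
  contradiction (≤-trans (counter I) (≤-reflexive (*-zeroʳ n))) λ ()
unpeel-step {n} {suc x} (suc D) (suc e) P x≤n x≤ I =
  unpeel-pass D P (≤-trans (≤-reflexive (cong suc (sym (+-suc x e)))) (room I (suc x) x≤ (s≤s z≤n) x≤n))

unpeel∘peel : ∀ {n xs} → Asc xs → All (_≤ n) xs →
  let (D , e , P) = peel n xs in unpeel n D e P ≡ xs
unpeel∘peel {xs = []} [] [] = refl
unpeel∘peel {n} {x ∷ xs} (x≤ ∷ s) (b ∷ bs) =
  trans (unpeel-step _ _ _ b x≤ (peel-peeled s bs)) (cong (x ∷_) (unpeel∘peel s bs))

-- X_0 of the lecture hall partition of level n built from the parts xs.
lead : ℕ → List ℕ → ℕ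
lead zero    xs = 0
lead (suc n) xs = let (D , e , _) = peel n xs in suc n * D ∸ e

counter≤ : ∀ n D {e} → e ≤ n * D → e ≤ suc n * D
counter≤ n D h = ≤-trans h (m≤n+m _ D)

-- A pass adds 1 to X_0, and so does a kept 0. A kept x > 0 adds x + 1, but only at counter 0, where
-- X_0 is a multiple of n + 1; later estimates use that multiple.
lead-cons : ∀ {n x P} → Asc P → All (_≤ n) P → x ≤ n → All (x ≤_) P →
  lead (suc n) (x ∷ P) ≡ suc (lead (suc n) P) ⊎
  (∃ λ D → lead (suc n) P ≡ suc n * D × lead (suc n) (x ∷ P) ≡ suc x + lead (suc n) P)
lead-cons {n} {x} {P} s b x≤n x≤ with peel n P | peel-peeled s b
lead-cons {n} {zero}  s b x≤n x≤ | D , e     , Q | I = inj₁ (begin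
    suc n * suc D ∸ (e + n)         ≡⟨ cong₂ _∸_ (eq n D) (+-comm e n) ⟩
    n + suc (suc n * D) ∸ (n + e)   ≡⟨ [m+n]∸[m+o]≡n∸o n _ e ⟩
    suc (suc n * D) ∸ e             ≡⟨ +-∸-assoc 1 (counter≤ n D (counter I)) ⟩
    suc (suc n * D ∸ e)             ∎)
  where open ≡-Reasoning
        eq : ∀ n D → suc n * suc D ≡ n + suc (suc n * D)
        eq = solve-∀
lead-cons {n} {suc x} s b x≤n x≤ | D , zero  , Q | I = inj₂ (D , refl , (begin
    suc n * suc D ∸ (n ∸ suc x)           ≡⟨ cong (_∸ (n ∸ suc x)) (eq n (suc n * D) (*-suc (suc n) D)) ⟩
    n + (suc (suc n * D)) ∸ (n ∸ suc x)   ≡⟨ +-∸-comm (suc (suc n * D)) (m∸n≤m n (suc x)) ⟩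
    (n ∸ (n ∸ suc x)) + suc (suc n * D)   ≡⟨ cong (_+ suc (suc n * D)) (m∸[m∸n]≡n x≤n) ⟩
    suc x + suc (suc n * D)               ≡⟨ +-suc (suc x) (suc n * D) ⟩
    suc (suc x) + (suc n * D)             ∎))
  where open ≡-Reasoning
        eq : ∀ n a {b} → b ≡ suc n + a → b ≡ n + suc a
        eq n a h = trans h (sym (+-suc n a))
lead-cons {n} {suc x} s b x≤n x≤ | D , suc e , Q | I =
  inj₁ (+-∸-assoc 1 {suc n * D} {suc e} (counter≤ n D (counter I)))

-- The witness e is the counter, so `room` limits how far X_0 falls short of a multiple of n + 1.
lead-head : ∀ {n x P} → Asc (x ∷ P) → All (_≤ n) (x ∷ P) → 1 ≤ x →
  ∃₂ λ D e → lead (suc n) (x ∷ P) + e ≡ suc n * D × x + e ≤ n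
lead-head {n} {x} {P} (x≤ ∷ s) (x≤n ∷ b) 1≤x with peel n (x ∷ P) | peel-peeled (x≤ ∷ s) (x≤n ∷ b)
... | D , e , Q | I = D , e , m∸n+n≡m (counter≤ n D (counter I)) , room I x (≤-refl ∷ x≤) 1≤x x≤n

-- Every insertion raises X_0 by at least 1.
length≤lead : ∀ {n P} → Asc P → All (_≤ n) P → length P ≤ lead (suc n) P
length≤lead [] [] = z≤n
length≤lead {P = x ∷ P} (x≤ ∷ s) (b ∷ bs) with lead-cons s bs b x≤
... | inj₁ q = ≤-trans (s≤s (length≤lead s bs)) (≤-reflexive (sym q))
... | inj₂ (_ , _ , q) = ≤-trans (s≤s (≤-trans (length≤lead s bs) (m≤n+m _ x))) (≤-reflexive (sym q))

-- Y / suc k ≥ X / k for Y = suc k * D ∸ e, with both sides moved so that no subtraction occurs.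
Fits : ℕ → ℕ → ℕ → ℕ → Set
Fits k D e X = suc k * X + k * e ≤ k * (suc k * D)

-- Adding e ≤ k turns the left side into a multiple of k + 1, while the right side stays below the
-- next multiple, so the division is exact enough. With `loosen`, the ratio condition becomes linear
-- for small counters.
tight : ∀ k D e X → e ≤ k → Fits k D e X → X + e ≤ k * D
tight k D e X e≤k h = s≤s⁻¹ (*-cancelˡ-< (suc k) (X + e) (suc (k * D)) (begin-strict
  suc k * (X + e)               ≡⟨ eq k X e ⟩
  suc k * X + k * e + e         ≤⟨ +-mono-≤ h e≤k ⟩
  k * (suc k * D) + k           <⟨ ≤-reflexive (eq′ k D) ⟩
  suc k * suc (k * D)           ∎))
  where open ≤-Reasoning
        eq : ∀ k X e → suc k * (X + e) ≡ suc k * X + k * e + e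
        eq = solve-∀
        eq′ : ∀ k D → suc (k * (suc k * D) + k) ≡ suc k * suc (k * D)
        eq′ = solve-∀

loosen : ∀ k D e X → X + e ≤ k * D → Fits k D e X
loosen k D e X h = begin
  suc k * X + k * e    ≤⟨ +-monoʳ-≤ (suc k * X) (m≤n+m (k * e) e) ⟩
  suc k * X + suc k * e ≡⟨ sym (*-distribˡ-+ (suc k) X e) ⟩
  suc k * (X + e)      ≤⟨ *-monoʳ-≤ (suc k) h ⟩
  suc k * (k * D)      ≡⟨ eq k D ⟩
  k * (suc k * D)      ∎
  where open ≤-Reasoning
        eq : ∀ k D → suc k * (k * D) ≡ k * (suc k * D)
        eq = solve-∀

-- Distinct multiples of k differ by at least k.
multiple-gap : ∀ k {D D′} a → k * D + a ≤ k * D′ → 1 ≤ a → k * D + k ≤ k * D′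
multiple-gap k {D} {D′} a h 1≤a = ≤-trans (≤-reflexive (trans (+-comm (k * D) k) (sym (*-suc k D))))
  (*-monoʳ-≤ k (*-cancelˡ-< k D D′ (<-≤-trans (≤-trans (≤-reflexive (+-comm 1 (k * D))) (+-monoʳ-≤ (k * D) 1≤a)) h)))

-- A pass trades one unit of counter for growth of X_1, the lead of P. Growth by 1 is an even trade.
-- A larger jump starts from a multiple of k lying strictly below k * D, hence at least k below it,
-- and `room` limits the jump plus the new counter to k.
step-fits : ∀ {k x} D e {xs} P → x ≤ suc k → All (x ≤_) xs → Peeled (suc k) xs D e P →
  Fits k D e (lead k P) →
  let (D′ , e′ , P′) = step (suc k) x (D , e , P) in Fits k D′ e′ (lead k P′)
step-fits {k} {zero} D e P x≤n x≤ I F = begin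
  suc k * lead k P + k * (e + suc k)     ≡⟨ eq k (lead k P) e ⟩
  (suc k * lead k P + k * e) + k * suc k ≤⟨ +-monoˡ-≤ (k * suc k) F ⟩
  k * (suc k * D) + k * suc k            ≡⟨ eq′ k D ⟩
  k * (suc k * suc D)                    ∎
  where open ≤-Reasoning
        eq : ∀ k X e → suc k * X + k * (e + suc k) ≡ (suc k * X + k * e) + k * suc k
        eq = solve-∀
        eq′ : ∀ k D → k * (suc k * D) + k * suc k ≡ k * (suc k * suc D)
        eq′ = solve-∀
step-fits {k} {suc x} D zero P x≤n x≤ I F = loosen k (suc D) (k ∸ x) (lead k P) (begin
  lead k P + (k ∸ x)  ≤⟨ +-mono-≤ (≤-trans (≤-reflexive (sym (+-identityʳ _))) (tight k D 0 (lead k P) z≤n F)) (m∸n≤m k x) ⟩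
  k * D + k           ≡⟨ trans (+-comm (k * D) k) (sym (*-suc k D)) ⟩
  k * suc D           ∎)
  where open ≤-Reasoning
step-fits {zero} {suc x} D (suc e) P x≤n x≤ I F =
  contradiction (≤-trans (m≤n+m (suc e) x) (s≤s⁻¹ (room I (suc x) x≤ (s≤s z≤n) x≤n))) λ ()
step-fits {suc n} {suc x} D (suc e) {xs} P x≤n x≤ I F =
  loosen k D e (lead k (x ∷ P)) (go (lead-cons (sorted I) (All.map s≤s⁻¹ (bounded I)) x≤′ x≤P))
  where
  open ≤-Reasoning
  k = suc n
  hr : suc x + suc e ≤ suc k
  hr = room I (suc x) x≤ (s≤s z≤n) x≤n
  e≤k : suc e ≤ k
  e≤k = s≤s⁻¹ (≤-trans (s≤s (m≤n+m (suc e) x)) hr)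
  x≤′ : x ≤ n
  x≤′ = s≤s⁻¹ (s≤s⁻¹ (≤-trans (≤-trans (s≤s (s≤s (m≤m+n x e))) (≤-reflexive (cong suc (sym (+-suc x e))))) hr))
  x≤P : All (x ≤_) P
  x≤P = All.map s≤s⁻¹ (above I (suc x) x≤)
  slack : lead k P + suc e ≤ k * D
  slack = tight k D (suc e) (lead k P) e≤k F
  go : _ → lead k (x ∷ P) + e ≤ k * D
  go (inj₁ q) = ≤-trans (≤-reflexive (trans (cong (_+ e) q) (sym (+-suc (lead k P) e)))) slack
  go (inj₂ (D′ , r , q)) = begin
    lead k (x ∷ P) + e      ≡⟨ cong (_+ e) q ⟩
    suc x + lead k P + e    ≡⟨ eq x (lead k P) e ⟩
    lead k P + (suc x + e)  ≤⟨ +-monoʳ-≤ (lead k P) (s≤s⁻¹ (≤-trans (≤-reflexive (sym (+-suc (suc x) e))) hr)) ⟩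
    lead k P + k            ≡⟨ cong (_+ k) r ⟩
    k * D′ + k              ≤⟨ multiple-gap k (suc e) (subst (λ z → z + suc e ≤ k * D) r slack) (s≤s z≤n) ⟩
    k * D                   ∎
    where eq : ∀ x l e → suc x + l + e ≡ l + (suc x + e)
          eq = solve-∀

peel-fits : ∀ {k xs} → Asc xs → All (_≤ suc k) xs →
  let (D , e , P) = peel (suc k) xs in Fits k D e (lead k P)
peel-fits {zero}  [] [] = z≤n
peel-fits {suc k} [] [] = loosen (suc k) 0 0 (lead (suc k) []) (≤-reflexive (+-identityʳ (lead (suc k) [])))
peel-fits {k} {x ∷ xs} (x≤ ∷ s) (b ∷ bs) =
  step-fits _ _ _ b x≤ (peel-peeled s bs) (peel-fits s bs)

-- Undoing an insertion

pass-fits : ∀ {k x} D e {P} → Asc (x ∷ P) → All (_< k) (x ∷ P) → suc x + e < suc k →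
  Fits k D e (lead k (x ∷ P)) → Fits k D (suc e) (lead k P)
pass-fits {suc n} {x} D e {P} (x≤ ∷ s) (x<k ∷ b) h F =
  loosen k D (suc e) (lead k P) (go (lead-cons s (All.map s≤s⁻¹ b) (s≤s⁻¹ x<k) x≤))
  where
  open ≤-Reasoning
  k = suc n
  e<k : suc e ≤ k
  e<k = ≤-trans (s≤s (m≤n+m e x)) (s≤s⁻¹ h)
  slack : lead k (x ∷ P) + e ≤ k * D
  slack = tight k D e (lead k (x ∷ P)) (≤-trans (n≤1+n e) e<k) F
  go : _ → lead k P + suc e ≤ k * D
  go (inj₁ q) = ≤-trans (≤-reflexive (trans (+-suc (lead k P) e) (cong (_+ e) (sym q)))) slack
  -- Removing x brings X_1 down to a multiple of k strictly below k * D, hence at least k below it,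
  -- which leaves space for the raised counter `suc e` ≤ k.
  go (inj₂ (D′ , r , q)) = begin
    lead k P + suc e  ≤⟨ +-mono-≤ (≤-reflexive r) e<k ⟩
    k * D′ + k        ≤⟨ multiple-gap k (suc x + e) (begin
      k * D′ + (suc x + e)  ≡⟨ cong (_+ (suc x + e)) (sym r) ⟩
      lead k P + (suc x + e) ≡⟨ eq (lead k P) (suc x) e ⟩
      suc x + lead k P + e   ≡⟨ cong (_+ e) (sym q) ⟩
      lead k (x ∷ P) + e     ≤⟨ slack ⟩
      k * D ∎) (s≤s z≤n) ⟩
    k * D             ∎
    where eq : ∀ l x e → l + (x + e) ≡ x + l + e
          eq = solve-∀

lead-[] : ∀ k → lead k [] ≡ 0
lead-[] zero    = refl
lead-[] (suc n) = *-zeroʳ n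

-- If e > k, a 0 was kept and both sides lose k * (k + 1). If e ≤ k, the earlier counter is 0 and
-- X_1 ≤ k * D has to follow from X_1 + e ≤ k * (D + 1); this is where the failed tests on P enter.
keep-fits : ∀ {k} D e {P} → Asc P → All (_< k) P → All (λ x → suc k ≤ suc x + e) P →
  Fits k (suc D) e (lead k P) → Fits k D (e ∸ suc k) (lead k P)
keep-fits {k} D e {P} s b h F with e ≤? k
... | no e≰k = +-cancelˡ-≤ (k * suc k) _ _ (begin
    k * suc k + (suc k * lead k P + k * (e ∸ suc k)) ≡⟨ eq k (lead k P) (e ∸ suc k) ⟩
    suc k * lead k P + k * (suc k + (e ∸ suc k))     ≡⟨ cong (λ z → suc k * lead k P + k * z) (m+[n∸m]≡n (≰⇒> e≰k)) ⟩
    suc k * lead k P + k * e                         ≤⟨ F ⟩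
    k * (suc k * suc D)                              ≡⟨ eq′ k D ⟩
    k * suc k + k * (suc k * D)                      ∎)
  where open ≤-Reasoning
        eq : ∀ k X e → k * suc k + (suc k * X + k * e) ≡ suc k * X + k * (suc k + e)
        eq = solve-∀
        eq′ : ∀ k D → k * (suc k * suc D) ≡ k * suc k + k * (suc k * D)
        eq′ = solve-∀
... | yes e≤k rewrite m≤n⇒m∸n≡0 (m≤n⇒m≤1+n e≤k) =
    loosen k D 0 (lead k P) (≤-trans (≤-reflexive (+-identityʳ (lead k P))) (go P s b h (tight k (suc D) e (lead k P) e≤k F)))
  where
  open ≤-Reasoning
  go : ∀ P → Asc P → All (_< k) P → All (λ x → suc k ≤ suc x + e) P → lead k P + e ≤ k * suc D → lead k P ≤ k * D
  go [] _ _ _ _ = ≤-trans (≤-reflexive (lead-[] k)) z≤n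
  -- A failed test at a passed 0 means e ≥ k, exactly the amount to cancel.
  go (zero ∷ P) s b (h ∷ _) slack = +-cancelʳ-≤ k _ _ (begin
    lead k (zero ∷ P) + k   ≤⟨ +-monoʳ-≤ (lead k (zero ∷ P)) (s≤s⁻¹ h) ⟩
    lead k (zero ∷ P) + e   ≤⟨ slack ⟩
    k * suc D               ≡⟨ trans (*-suc k D) (+-comm k (k * D)) ⟩
    k * D + k               ∎)
  go (suc x ∷ P) s b (h ∷ _) slack = inner s b h slack
    where
    inner : ∀ {k} → Asc (suc x ∷ P) → All (_< k) (suc x ∷ P) → suc k ≤ suc (suc x) + e →
      lead k (suc x ∷ P) + e ≤ k * suc D → lead k (suc x ∷ P) ≤ k * D
    inner {zero} s (() ∷ _) h slack
    -- X_1 lies e′ below the multiple `suc n * D′`, and the failed test gives e′ < e. So that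
    -- multiple is strictly below `suc n * suc D`, whence D′ ≤ D.
    inner {suc n} s b h slack with lead-head s (All.map s≤s⁻¹ b) (s≤s z≤n)
    ... | D′ , e′ , q , r = +-cancelʳ-≤ (suc n) _ _ (begin
        X + suc n             ≤⟨ +-monoˡ-≤ (suc n) (≤-trans (m≤m+n X e′) (≤-reflexive q)) ⟩
        suc n * D′ + suc n    ≤⟨ multiple-gap (suc n) (e ∸ e′) (begin
           suc n * D′ + (e ∸ e′)   ≡⟨ cong (_+ (e ∸ e′)) (sym q) ⟩
           X + e′ + (e ∸ e′)       ≡⟨ +-assoc X e′ (e ∸ e′) ⟩
           X + (e′ + (e ∸ e′))     ≡⟨ cong (X +_) (m+[n∸m]≡n (<⇒≤ e′<e)) ⟩
           X + e                   ≤⟨ slack ⟩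
           suc n * suc D           ∎) (m<n⇒0<n∸m e′<e) ⟩
        suc n * suc D         ≡⟨ trans (*-suc (suc n) D) (+-comm (suc n) (suc n * D)) ⟩
        suc n * D + suc n     ∎)
      where
      X = lead (suc n) (suc x ∷ P)
      e′<e : e′ < e
      e′<e = +-cancelˡ-< (suc x) e′ e (<-≤-trans (s≤s r) (s≤s⁻¹ h))

-- These properties hold for every state that `peel` produces from a sorted bounded list. They
-- persist when an insertion is undone, and `peel-unpeel` shows that they suffice for inverting
-- `unpeel`.
record Reachable (k D e : ℕ) (P : List ℕ) : Set where
  field
    ctr  : e ≤ suc k * D
    asc  : Asc P
    bnd  : All (_< k) P
    fits : Fits k D e (lead k P)
open Reachable

reach-pass : ∀ {k x D e P} → suc x + e < suc k → Reachable k (suc D) e (x ∷ P) → Reachable k (suc D) (suc e) P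
reach-pass {k} {x} {D} {e} h R = record
  { ctr  = ≤-trans (≤-trans (s≤s (m≤n+m e x)) (≤-trans (n≤1+n _) h))
             (≤-trans (m≤m+n (suc k) (suc k * D)) (≤-reflexive (sym (*-suc (suc k) D))))
  ; asc  = AllPairs.tail (asc R)
  ; bnd  = All.tail (bnd R)
  ; fits = pass-fits (suc D) e (asc R) (bnd R) h (fits R) }

reach-keep : ∀ {k D e P} → All (λ x → suc k ≤ suc x + e) P → Reachable k (suc D) e P → Reachable k D (e ∸ suc k) P
reach-keep {k} {D} {e} h R = record
  { ctr  = ≤-trans (∸-monoˡ-≤ (suc k) (ctr R)) (≤-reflexive (trans (cong (_∸ suc k) (*-suc (suc k) D)) (m+n∸m≡n (suc k) _)))
  ; asc  = asc R
  ; bnd  = bnd R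
  ; fits = keep-fits D e (asc R) (bnd R) h (fits R) }

step-keep : ∀ {n} D e P → step n (n ∸ e) (D , e ∸ n , P) ≡ (suc D , e , P)
step-keep {n} D e P with ≤-total n e
... | inj₁ n≤e rewrite m≤n⇒m∸n≡0 n≤e | m∸n+n≡m n≤e = refl
... | inj₂ e≤n rewrite m≤n⇒m∸n≡0 e≤n = go (n ∸ e) refl
  where
  go : ∀ x → n ∸ e ≡ x → step n x (D , 0 , P) ≡ (suc D , e , P)
  go zero    q = cong (λ z → suc D , z , P) (≤-antisym (m∸n≡0⇒m≤n q) e≤n)
  go (suc x) q = cong (λ z → suc D , z , P) (trans (cong (n ∸_) (sym q)) (m∸[m∸n]≡n e≤n))

-- D = 0 forces the counter to 0, then `fits` forces the lead of P to 0, and the lead bounds the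
-- number of parts.
reach-zero : ∀ {k e P} → Reachable k 0 e P → e ≡ 0 × P ≡ []
reach-zero {k} {e} {P} R with n≤0⇒n≡0 (≤-trans (ctr R) (≤-reflexive (*-zeroʳ k)))
... | refl = refl , go k P (asc R) (bnd R) (fits R)
  where
  go : ∀ k P → Asc P → All (_< k) P → Fits k 0 0 (lead k P) → P ≡ []
  go k [] _ _ _ = refl
  go zero (x ∷ P) s (() ∷ _) F
  go (suc n) (x ∷ P) s b F = contradiction (≤-trans (≤-trans (length≤lead s (All.map s≤s⁻¹ b)) (≤-trans (m≤m+n _ 0)
    (tight (suc n) 0 0 (lead (suc n) (x ∷ P)) z≤n F))) (≤-reflexive (*-zeroʳ n))) λ ()

-- The graph of `unpeel`, for induction on a run without repeating the Boolean test. In `keep` the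
-- test fails on all of P, which follows from its head by sortedness and supplies the lower bounds
-- for `unpeel-asc`.
data Unpeel (n : ℕ) : ℕ → ℕ → List ℕ → List ℕ → Set where
  stop : ∀ {e P} → Unpeel n 0 e P []
  pass : ∀ {D e x P ys} → suc x + e < n →
         Unpeel n (suc D) (suc e) P ys → Unpeel n (suc D) e (x ∷ P) (suc x ∷ ys)
  keep : ∀ {D e P ys} → All (λ x → n ≤ suc x + e) P →
         Unpeel n D (e ∸ n) P ys → Unpeel n (suc D) e P ((n ∸ e) ∷ ys)

unpeel-graph : ∀ n D e P → Asc P → Unpeel n D e P (unpeel n D e P)
unpeel-graph n zero    e P s  = stop
unpeel-graph n (suc D) e [] s = keep [] (unpeel-graph n D (e ∸ n) [] s)
unpeel-graph n (suc D) e (x ∷ P) (x≤ ∷ s) =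
  [ (λ h → subst (Unpeel n (suc D) e (x ∷ P)) (sym (unpeel-pass D P h))
             (pass h (unpeel-graph n (suc D) (suc e) P s)))
  , (λ h → subst (Unpeel n (suc D) e (x ∷ P)) (sym (unpeel-keep D P h))
             (keep (h ∷ All.map (λ q → ≤-trans h (+-monoˡ-≤ e (s≤s q))) x≤)
                   (unpeel-graph n D (e ∸ n) (x ∷ P) (x≤ ∷ s))))
  ]′ (<-≤-connex (suc x + e) n)

peel-unpeel : ∀ {k D e P ys} → Unpeel (suc k) D e P ys → Reachable k D e P → peel (suc k) ys ≡ (D , e , P)
peel-unpeel stop R with reach-zero R
... | refl , refl = refl
peel-unpeel {k} (pass {x = x} h U) R = cong (step (suc k) (suc x)) (peel-unpeel U (reach-pass h R))
peel-unpeel {k} (keep {D} {e} {P} h U) R =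
  trans (cong (step (suc k) (suc k ∸ e)) (peel-unpeel U (reach-keep h R))) (step-keep D e P)

unpeel-bounded : ∀ {n D e P ys} → Unpeel n D e P ys → All (_≤ n) ys
unpeel-bounded stop = []
unpeel-bounded (pass {x = x} h U) = <⇒≤ (≤-<-trans (m≤m+n (suc x) _) h) ∷ unpeel-bounded U
unpeel-bounded {n} (keep {e = e} h U) = m∸n≤m n e ∷ unpeel-bounded U

next≤ : ∀ {x e n} → suc x + e < n → suc x ≤ n ∸ suc e
next≤ {x} {e} h = ≤-trans (≤-reflexive (sym (m+n∸n≡m (suc x) (suc e))))
  (∸-monoˡ-≤ (suc e) (≤-trans (≤-reflexive (+-suc (suc x) e)) h))

-- The part `n ∸ e` that a keep would return is carried along: a pass lowers it, but by the test not
-- below the part just returned, and a keep never lowers it.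
unpeel-above : ∀ {n D e P ys b} → Unpeel n D e P ys → All (λ x → b ≤ suc x) P → b ≤ n ∸ e → All (b ≤_) ys
unpeel-above stop _ _ = []
unpeel-above (pass h U) (b≤ ∷ bs) _ = b≤ ∷ unpeel-above U bs (≤-trans b≤ (next≤ h))
unpeel-above {n} (keep {e = e} h U) bs b≤ = b≤ ∷ unpeel-above U bs (≤-trans b≤ (∸-monoʳ-≤ n (m∸n≤m e n)))

unpeel-asc : ∀ {n D e P ys} → Unpeel n D e P ys → Asc P → Asc ys
unpeel-asc stop _ = []
unpeel-asc (pass h U) (x≤ ∷ s) = unpeel-above U (All.map s≤s x≤) (next≤ h) ∷ unpeel-asc U s
unpeel-asc {n} (keep {e = e} h U) s =
  unpeel-above U (All.map (λ {y} r → ≤-trans (∸-monoˡ-≤ e r) (≤-reflexive (m+n∸n≡m (suc y) e))) h)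
    (∸-monoʳ-≤ n (m∸n≤m e n))
  ∷ unpeel-asc U s

-- Lecture hall partitions as lists of blocks

-- A block (D , Y) stands for m consecutive parts whose first one is D + Y and whose last one is Y.
Block : Set
Block = ℕ × ℕ

first : List Block → ℕ
first []             = 0
first ((D , Y) ∷ bs) = D + Y

sumD sumY : List Block → ℕ
sumD bs = sum (map proj₁ bs)
sumY bs = sum (map proj₂ bs)

-- With X = D + Y and X′ the first part of the remaining blocks, `lh2` says X / (k + 2) ≥ Y / (k +
-- 1) ≥ X′ / k; the first inequality simplifies to a bound on Y by D. At level 1 the fraction Y / 0
-- forces Y = 0.
data LectureHall : ℕ → List Block → Set where
  lh0 : LectureHall 0 []
  lh1 : ∀ {D} → LectureHall 1 ((D , 0) ∷ [])
  lh2 : ∀ {k D Y bs} → Y ≤ suc k * D → suc k * first bs ≤ k * Y → LectureHall k bs →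
        LectureHall (2 + k) ((D , Y) ∷ bs)

Sorted< : ℕ → List ℕ → Set
Sorted< n xs = Asc xs × All (_< n) xs

-- Numbers below 1 are all 0, so only their count is recorded at level 1. A block takes up two
-- entries of the lecture hall partition, so the level falls by 2.
toBlocks : ℕ → List ℕ → List Block
toBlocks 0 xs = []
toBlocks 1 xs = (length xs , 0) ∷ []
toBlocks (suc (suc k)) xs = let (D , e , P) = peel (suc k) xs in (D , suc k * D ∸ e) ∷ toBlocks k P

fromBlocks : ℕ → List Block → List ℕ
fromBlocks _ [] = []
fromBlocks 0 (_ ∷ _) = []
fromBlocks 1 ((D , _) ∷ _) = replicate D 0
fromBlocks (suc (suc k)) ((D , Y) ∷ bs) = unpeel (suc k) D (suc k * D ∸ Y) (fromBlocks k bs)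

zeros : ∀ {xs} → All (_< 1) xs → xs ≡ replicate (length xs) 0
zeros [] = refl
zeros (s≤s z≤n ∷ h) = cong (0 ∷_) (zeros h)

peel-zeros : ∀ D → peel 0 (replicate D 0) ≡ (D , 0 , [])
peel-zeros zero    = refl
peel-zeros (suc D) rewrite peel-zeros D = refl

first-toBlocks : ∀ k {xs} → Sorted< k xs → first (toBlocks k xs) ≡ lead k xs
first-toBlocks zero          _       = refl
first-toBlocks (suc zero)    {xs} (s , b) rewrite zeros b | peel-zeros (length xs) | length-replicate (length xs) {0} = refl
first-toBlocks (suc (suc k)) {xs} (s , b) with peel (suc k) xs | peel-peeled s (All.map s≤s⁻¹ b)
... | D , e , P | I = sym (+-∸-assoc D (counter I))

toBlocks-lectureHall : ∀ n {xs} → Sorted< n xs → LectureHall n (toBlocks n xs)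
toBlocks-lectureHall zero       _ = lh0
toBlocks-lectureHall (suc zero) _ = lh1
toBlocks-lectureHall (suc (suc k)) {xs} (s , b)
  with peel (suc k) xs | peel-peeled s (All.map s≤s⁻¹ b) | peel-fits s (All.map s≤s⁻¹ b)
... | D , e , P | I | F = lh2 (m∸n≤m _ e) (begin
    suc k * first (toBlocks k P)           ≡⟨ cong (suc k *_) (first-toBlocks k (sorted I , bounded I)) ⟩
    suc k * lead k P                ≡⟨ sym (m+n∸n≡m _ (k * e)) ⟩
    suc k * lead k P + k * e ∸ k * e ≤⟨ ∸-monoˡ-≤ (k * e) F ⟩
    k * (suc k * D) ∸ k * e         ≡⟨ sym (*-distribˡ-∸ k (suc k * D) e) ⟩
    k * (suc k * D ∸ e)             ∎) (toBlocks-lectureHall k (sorted I , bounded I))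
  where open ≤-Reasoning

sum-zeros : ∀ D → sum (replicate D 0) ≡ 0
sum-zeros zero    = refl
sum-zeros (suc D) = sum-zeros D

toBlocks-sumD : ∀ n {xs} → Sorted< n xs → sumD (toBlocks n xs) ≡ length xs
toBlocks-sumD zero       ([] , []) = refl
toBlocks-sumD zero       (_ , () ∷ _)
toBlocks-sumD (suc zero) _ = +-identityʳ _
toBlocks-sumD (suc (suc k)) {xs} (s , b) with peel (suc k) xs | peel-peeled s (All.map s≤s⁻¹ b)
... | D , e , P | I = trans (cong (D +_) (toBlocks-sumD k (sorted I , bounded I))) (sym (size I))

toBlocks-sumY : ∀ n {xs} → Sorted< n xs → sumY (toBlocks n xs) ≡ sum xs
toBlocks-sumY zero       ([] , []) = refl
toBlocks-sumY zero       (_ , () ∷ _)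
toBlocks-sumY (suc zero) {xs} (_ , b) = trans (sym (sum-zeros (length xs))) (cong sum (sym (zeros b)))
toBlocks-sumY (suc (suc k)) {xs} (s , b) with peel (suc k) xs | peel-peeled s (All.map s≤s⁻¹ b)
... | D , e , P | I = begin
    suc k * D ∸ e + sumY (toBlocks k P) ≡⟨ cong (suc k * D ∸ e +_) (toBlocks-sumY k (sorted I , bounded I)) ⟩
    suc k * D ∸ e + sum P        ≡⟨ sym (+-∸-comm (sum P) (counter I)) ⟩
    suc k * D + sum P ∸ e        ≡⟨ cong (_∸ e) (sym (weight I)) ⟩
    sum xs + e ∸ e               ≡⟨ m+n∸n≡m (sum xs) e ⟩
    sum xs                       ∎
  where open ≡-Reasoning

fromBlocks∘toBlocks : ∀ n {xs} → Sorted< n xs → fromBlocks n (toBlocks n xs) ≡ xs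
fromBlocks∘toBlocks zero       ([] , []) = refl
fromBlocks∘toBlocks zero       (_ , () ∷ _)
fromBlocks∘toBlocks (suc zero) (_ , b) = sym (zeros b)
fromBlocks∘toBlocks (suc (suc k)) {xs} (s , b)
  with peel (suc k) xs | peel-peeled s (All.map s≤s⁻¹ b) | unpeel∘peel s (All.map s≤s⁻¹ b)
... | D , e , P | I | u = trans (cong₂ (unpeel (suc k) D) (m∸[m∸n]≡n (counter I)) (fromBlocks∘toBlocks k (sorted I , bounded I))) u

fromBlocks-reachable : ∀ {k D Y bs} → Y ≤ suc k * D → suc k * first bs ≤ k * Y →
  Sorted< k (fromBlocks k bs) → lead k (fromBlocks k bs) ≡ first bs → Reachable k D (suc k * D ∸ Y) (fromBlocks k bs)
fromBlocks-reachable {k} {D} {Y} {bs} h₁ h₂ (s , b) q = record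
  { ctr = m∸n≤m _ Y ; asc = s ; bnd = b ; fits = begin
      suc k * lead k (fromBlocks k bs) + k * e  ≡⟨ cong (λ z → suc k * z + k * e) q ⟩
      suc k * first bs + k * e         ≤⟨ +-monoˡ-≤ (k * e) h₂ ⟩
      k * Y + k * e                    ≡⟨ sym (*-distribˡ-+ k Y e) ⟩
      k * (Y + e)                      ≡⟨ cong (k *_) (m+[n∸m]≡n h₁) ⟩
      k * (suc k * D)                  ∎ }
  where open ≤-Reasoning
        e = suc k * D ∸ Y

zeros-sorted : ∀ D → Sorted< 1 (replicate D 0)
zeros-sorted zero = [] , []
zeros-sorted (suc D) with zeros-sorted D
... | s , b = All.map (λ _ → z≤n) b ∷ s , s≤s z≤n ∷ b

-- Both claims are proved together because reachability at one level needs sortedness and the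
-- inverse property two levels below.
fromBlocks-spec : ∀ {n bs} → LectureHall n bs → Sorted< n (fromBlocks n bs) × toBlocks n (fromBlocks n bs) ≡ bs
fromBlocks-spec lh0 = ([] , []) , refl
fromBlocks-spec (lh1 {D}) = zeros-sorted D , cong (λ z → (z , 0) ∷ []) (length-replicate D)
fromBlocks-spec (lh2 {k} {D} {Y} {bs} h₁ h₂ L) with fromBlocks-spec L
... | S , q = (unpeel-asc U (proj₁ S) , All.map s≤s (unpeel-bounded U)) , inverse
  where
  U = unpeel-graph (suc k) D (suc k * D ∸ Y) (fromBlocks k bs) (proj₁ S)
  R = fromBlocks-reachable {bs = bs} h₁ h₂ S (trans (sym (first-toBlocks k S)) (cong first q))
  inverse : toBlocks (2 + k) (fromBlocks (2 + k) ((D , Y) ∷ bs)) ≡ (D , Y) ∷ bs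
  inverse rewrite peel-unpeel U R = cong₂ (λ z zs → (D , z) ∷ zs) (m∸[m∸n]≡n h₁) q

-- Partitions from blocks

Mono : (ℕ → ℕ) → Set
Mono f = ∀ j → f (suc j) ≤ f j

mono-≤ : ∀ {f} → Mono f → ∀ {i j} → i ≤ j → f j ≤ f i
mono-≤ {f} h {i} {j} i≤j with m≤n⇒∃[o]m+o≡n i≤j
... | d , refl = go d
  where
  go : ∀ d → f (i + d) ≤ f i
  go zero    = ≤-reflexive (cong f (+-identityʳ i))
  go (suc d) = ≤-trans (≤-reflexive (cong f (+-suc i d))) (≤-trans (h (i + d)) (go d))

-- Zero-based, unlike `part`, so that column j < m of block i is entry i * m + j.
at : List ℕ → ℕ → ℕ
at []       _       = 0
at (x ∷ _)  zero    = x
at (_ ∷ xs) (suc j) = at xs j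

at-applyUpTo-< : ∀ g m r {j} → j < m → at (applyUpTo g m ++ r) j ≡ g j
at-applyUpTo-< g (suc m) r {zero}  _       = refl
at-applyUpTo-< g (suc m) r {suc j} (s≤s h) = at-applyUpTo-< (g ∘ suc) m r h

at-applyUpTo-+ : ∀ g m r j → at (applyUpTo g m ++ r) (m + j) ≡ at r j
at-applyUpTo-+ g zero    r j = refl
at-applyUpTo-+ g (suc m) r j = at-applyUpTo-+ (g ∘ suc) m r j

split-index : ∀ m j → j < m ⊎ ∃ λ i → j ≡ m + i
split-index m j = [ inj₁ , (λ h → inj₂ (j ∸ m , sym (m+[n∸m]≡n h))) ]′ (<-≤-connex j m)

sum-applyUpTo-+ : ∀ f g n → sum (applyUpTo (λ j → f j + g j) n) ≡ sum (applyUpTo f n) + sum (applyUpTo g n)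
sum-applyUpTo-+ f g zero    = refl
sum-applyUpTo-+ f g (suc n) = trans (cong (f 0 + g 0 +_) (sum-applyUpTo-+ (f ∘ suc) (g ∘ suc) n))
  (eq (f 0) (g 0) (sum (applyUpTo (f ∘ suc) n)) (sum (applyUpTo (g ∘ suc) n)))
  where eq : ∀ a b c d → a + b + (c + d) ≡ (a + c) + (b + d)
        eq = solve-∀

sum-applyUpTo-const : ∀ c n → sum (applyUpTo (λ _ → c) n) ≡ n * c
sum-applyUpTo-const c zero    = refl
sum-applyUpTo-const c (suc n) = cong (c +_) (sum-applyUpTo-const c n)

applyUpTo-cong : ∀ {A : Set} {f g : ℕ → A} n → (∀ j → j < n → f j ≡ g j) → applyUpTo f n ≡ applyUpTo g n
applyUpTo-cong zero    h = refl
applyUpTo-cong (suc n) h = cong₂ _∷_ (h 0 (s≤s z≤n)) (applyUpTo-cong n (λ j p → h (suc j) (s≤s p)))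

module Modulus (M : ℕ) where

  m : ℕ
  m = suc M

  shift : (ℕ → ℕ) → ℕ → ℕ
  shift f j = f (m + j)

  Mono-shift : ∀ {f} → Mono f → Mono (shift f)
  Mono-shift {f} h j = ≤-trans (≤-reflexive (cong f (+-suc m j))) (h (m + j))

  -- Conditions (1) and (2) block by block. The third conjunct is (1) in terms of columns: a column
  -- above the minimum of its block carries the maximum of the next block.
  Lecture : ℕ → (ℕ → ℕ) → Set
  Lecture 0 f = ∀ j → f j ≡ 0
  Lecture 1 f = f M ≡ 0
  Lecture (suc (suc k)) f =
    f M * (2 + k) ≤ f 0 * (1 + k) × f m * (1 + k) ≤ f M * k ×
    (∀ j → j < m → f M < f j → f (m + j) ≡ f m) × Lecture k (shift f)

  blocks : ℕ → (ℕ → ℕ) → List Block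
  blocks 0 f = []
  blocks 1 f = (f 0 ∸ f M , f M) ∷ []
  blocks (suc (suc k)) f = (f 0 ∸ f M , f M) ∷ blocks k (shift f)

  -- For j < m this is A_j = s_1 + ... + s_j, as `psum-drops` will show.
  drops : ℕ → (ℕ → ℕ) → ℕ → ℕ
  drops 0 f j = 0
  drops 1 f j = f 0 ∸ f j
  drops (suc (suc k)) f j = f 0 ∸ f j + drops k (shift f) j

  blocks-sumD : ∀ n f → sumD (blocks n f) ≡ drops n f M
  blocks-sumD 0 f = refl
  blocks-sumD 1 f = +-identityʳ _
  blocks-sumD (suc (suc k)) f = cong (f 0 ∸ f M +_) (blocks-sumD k (shift f))

  blocks-first : ∀ n {f} → Mono f → Lecture n f → first (blocks n f) ≡ f 0
  blocks-first 0 h R = sym (R 0)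
  blocks-first 1 h R = m∸n+n≡m (mono-≤ h z≤n)
  blocks-first (suc (suc k)) h R = m∸n+n≡m (mono-≤ h z≤n)

  blocks-lectureHall : ∀ n {f} → Mono f → Lecture n f → LectureHall n (blocks n f)
  blocks-lectureHall 0 h R = lh0
  blocks-lectureHall 1 {f} h R = subst (λ z → LectureHall 1 ((f 0 ∸ f M , z) ∷ [])) (sym R) lh1
  blocks-lectureHall (suc (suc k)) {f} h (R₁ , R₂ , _ , R) = lh2
      (begin
        f M                                     ≡⟨ sym (m+n∸n≡m (f M) (suc k * f M)) ⟩
        f M + suc k * f M ∸ suc k * f M         ≤⟨ ∸-monoˡ-≤ (suc k * f M)
             (subst₂ _≤_ (*-comm (f M) (2 + k)) (*-comm (f 0) (suc k)) R₁) ⟩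
        suc k * f 0 ∸ suc k * f M               ≡⟨ sym (*-distribˡ-∸ (suc k) (f 0) (f M)) ⟩
        suc k * (f 0 ∸ f M)                     ∎)
      (begin
        suc k * first (blocks k (shift f)) ≡⟨ cong (suc k *_) (trans (blocks-first k (Mono-shift h) R) (cong f (+-identityʳ m))) ⟩
        suc k * f m                        ≡⟨ *-comm (suc k) (f m) ⟩
        f m * suc k                        ≤⟨ R₂ ⟩
        f M * k                            ≡⟨ *-comm (f M) k ⟩
        k * f M                            ∎)
      (blocks-lectureHall k (Mono-shift h) R)
    where open ≤-Reasoning

  ratio-zero : ∀ k x → x * (2 + k) ≤ x * (1 + k) → x ≡ 0
  ratio-zero k zero    _ = refl
  ratio-zero k (suc x) h = contradiction (*-cancelˡ-≤ (suc x) h) (<-irrefl refl)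

  drops-zero : ∀ n {f} → (∀ j → f j ≡ 0) → ∀ j → drops n f j ≡ 0
  drops-zero 0 h j = refl
  drops-zero 1 {f} h j = trans (cong (_∸ f j) (h 0)) (0∸n≡0 (f j))
  drops-zero (suc (suc k)) {f} h j =
    cong₂ _+_ (trans (cong (_∸ f j) (h 0)) (0∸n≡0 (f j))) (drops-zero k (λ j → h (m + j)) j)

  -- If column j is above the minimum of its block, the column condition makes it flat in the next
  -- block too. Otherwise the block is constant, hence 0 by its ratio, and so is everything after
  -- it.
  drops-flat : ∀ n {f} → Mono f → Lecture n f → ∀ {j} → j < m → f j ≡ f 0 → drops n f j ≡ 0
  drops-flat 0 h R j<m q = refl
  drops-flat 1 {f} h R j<m q = trans (cong (f 0 ∸_) q) (n∸n≡0 (f 0))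
  drops-flat (suc (suc k)) {f} h (R₁ , R₂ , R₃ , R) {j} j<m q
    rewrite q | n∸n≡0 (f 0) with f M <? f j
  ... | yes p = drops-flat k (Mono-shift h) R j<m (trans (R₃ j j<m p) (cong f (sym (+-identityʳ m))))
  ... | no ¬p = drops-zero k (λ i → n≤0⇒n≡0 (≤-trans (mono-≤ h {M} (≤-trans (n≤1+n M) (m≤m+n m i))) (≤-reflexive fM≡0))) j
    where
    fM≡f0 : f M ≡ f 0
    fM≡f0 = ≤-antisym (mono-≤ h z≤n) (≤-trans (≤-reflexive (sym q)) (≮⇒≥ ¬p))
    fM≡0 : f M ≡ 0
    fM≡0 = ratio-zero k (f M) (subst (λ z → f M * (2 + k) ≤ z * (1 + k)) (sym fM≡f0) R₁)

  -- A column where the first block has not yet reached its minimum is constant in all later blocks, so the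
  -- total drop up to that column comes from the first block alone.
  block-entry : ∀ k {f} → Mono f → Lecture (2 + k) f → ∀ {j} → j < m →
    f M + (f 0 ∸ f M ∸ drops (2 + k) f j) ≡ f j ×
    drops (2 + k) f j ∸ (f 0 ∸ f M) ≡ drops k (shift f) j
  block-entry k {f} h (R₁ , R₂ , R₃ , R) {j} j<m with f M <? f j
  ... | yes p rewrite drops-flat k (Mono-shift h) R j<m (trans (R₃ j j<m p) (cong f (sym (+-identityʳ m))))
                    | +-identityʳ (f 0 ∸ f j) =
        trans (cong (f M +_) (trans (∸-+-assoc (f 0) (f M) (f 0 ∸ f j))
                (trans (cong (f 0 ∸_) (+-comm (f M) (f 0 ∸ f j)))
                  (trans (sym (∸-+-assoc (f 0) (f 0 ∸ f j) (f M))) (cong (_∸ f M) (m∸[m∸n]≡n (mono-≤ h z≤n)))))))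
          (m+[n∸m]≡n (<⇒≤ p))
      , m≤n⇒m∸n≡0 (∸-monoʳ-≤ (f 0) (<⇒≤ p))
  ... | no ¬p rewrite ≤-antisym (≮⇒≥ ¬p) (mono-≤ h (s≤s⁻¹ j<m)) =
        trans (cong (f M +_) (m≤n⇒m∸n≡0 (m≤m+n (f 0 ∸ f M) _))) (+-identityʳ (f M))
      , m+n∸m≡n (f 0 ∸ f M) _

  -- Of the total fall A_j required up to column j, each block absorbs as much as its D allows and
  -- leaves `A j ∸ D` to the later ones.
  build : (ℕ → ℕ) → List Block → List ℕ
  build A [] = []
  build A ((D , Y) ∷ bs) = applyUpTo (λ j → Y + (D ∸ A j)) m ++ build (λ j → A j ∸ D) bs

  build-< : ∀ A D Y bs {j} → j < m → at (build A ((D , Y) ∷ bs)) j ≡ Y + (D ∸ A j)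
  build-< A D Y bs = at-applyUpTo-< (λ j → Y + (D ∸ A j)) m _

  build-+ : ∀ A D Y bs i → at (build A ((D , Y) ∷ bs)) (m + i) ≡ at (build (λ j → A j ∸ D) bs) i
  build-+ A D Y bs = at-applyUpTo-+ (λ j → Y + (D ∸ A j)) m _

  build-blocks : ∀ n {f} A → Mono f → Lecture n f → (∀ j → j < m → A j ≡ drops n f j) →
    ∀ j → at (build A (blocks n f)) j ≡ f j
  build-blocks 0 A h R q j = sym (R j)
  build-blocks 1 {f} A h R q j with split-index m j
  ... | inj₁ j<m = trans (build-< A (f 0 ∸ f M) (f M) [] j<m)
          (trans (cong₂ (λ z y → z + (f 0 ∸ z ∸ y)) R (q j j<m)) (m∸[m∸n]≡n (mono-≤ h z≤n)))
  ... | inj₂ (i , refl) = trans (build-+ A (f 0 ∸ f M) (f M) [] i)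
          (sym (n≤0⇒n≡0 (≤-trans (mono-≤ h (≤-trans (n≤1+n M) (m≤m+n m i))) (≤-reflexive R))))
  build-blocks (suc (suc k)) {f} A h R q j with split-index m j
  ... | inj₁ j<m = trans (build-< A (f 0 ∸ f M) (f M) (blocks k (shift f)) j<m)
          (trans (cong (λ z → f M + (f 0 ∸ f M ∸ z)) (q j j<m)) (proj₁ (block-entry k h R j<m)))
  ... | inj₂ (i , refl) = trans (build-+ A (f 0 ∸ f M) (f M) (blocks k (shift f)) i)
          (build-blocks k _ (Mono-shift h) (proj₂ (proj₂ (proj₂ R)))
            (λ j j<m → trans (cong (_∸ (f 0 ∸ f M)) (q j j<m)) (proj₂ (block-entry k h R j<m))) i)

  -- With these bounds every block starts at its maximum and reaches its minimum exactly when the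
  -- last column is reached; the tail inherits them.
  record Admissible (A : ℕ → ℕ) (bs : List Block) : Set where
    field
      start : A 0 ≡ 0
      mono  : ∀ j → A j ≤ A (suc j)
      total : A M ≡ sumD bs
  open Admissible

  Admissible-tail : ∀ {A D Y bs} → Admissible A ((D , Y) ∷ bs) → Admissible (λ j → A j ∸ D) bs
  Admissible-tail {D = D} a = record
    { start = trans (cong (_∸ D) (start a)) (0∸n≡0 D)
    ; mono  = λ j → ∸-monoˡ-≤ D (mono a j)
    ; total = trans (cong (_∸ D) (total a)) (m+n∸m≡n D _) }

  Admissible-≤ : ∀ {A bs} → Admissible A bs → ∀ {j} → j ≤ M → A j ≤ sumD bs
  Admissible-≤ {A} a {j} j≤M with m≤n⇒∃[o]m+o≡n j≤M
  ... | d , refl = ≤-trans (go d) (≤-reflexive (total a))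
    where
    go : ∀ d → A j ≤ A (j + d)
    go zero    = ≤-reflexive (cong A (sym (+-identityʳ j)))
    go (suc d) = ≤-trans (go d) (≤-trans (mono a (j + d)) (≤-reflexive (cong A (sym (+-suc j d)))))

  build-0 : ∀ {A bs} → Admissible A bs → at (build A bs) 0 ≡ first bs
  build-0 {bs = []} a = refl
  build-0 {bs = (D , Y) ∷ bs} a rewrite start a = +-comm Y D

  build-M : ∀ {A D Y bs} → Admissible A ((D , Y) ∷ bs) → at (build A ((D , Y) ∷ bs)) M ≡ Y
  build-M {A} {D} {Y} {bs} a = trans (build-< A D Y bs (n<1+n M))
    (trans (cong (Y +_) (m≤n⇒m∸n≡0 (≤-trans (m≤m+n D _) (≤-reflexive (sym (total a)))))) (+-identityʳ Y))

  first≤ : ∀ {k D Y bs} → LectureHall (2 + k) ((D , Y) ∷ bs) → first bs ≤ Y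
  first≤ {k} (lh2 {Y = Y} _ h _) = *-cancelˡ-≤ (suc k) (≤-trans h (m≤n+m (k * Y) Y))

  first-tail≤ : ∀ {n D Y bs} → LectureHall n ((D , Y) ∷ bs) → first bs ≤ Y
  first-tail≤ lh1 = z≤n
  first-tail≤ L@(lh2 _ _ _) = first≤ L

  tail-mono : ∀ {n A D Y bs} → LectureHall n ((D , Y) ∷ bs) → Admissible A ((D , Y) ∷ bs) →
    Mono (at (build (λ j → A j ∸ D) bs)) → Mono (at (build A ((D , Y) ∷ bs)))
  tail-mono {A = A} {D} {Y} {bs} L a h j with split-index m j
  ... | inj₂ (i , refl) = ≤-trans (≤-reflexive (trans (cong (at (build A ((D , Y) ∷ bs))) (sym (+-suc m i))) (build-+ A D Y bs (suc i))))
          (≤-trans (h i) (≤-reflexive (sym (build-+ A D Y bs i))))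
  ... | inj₁ j<m with split-index m (suc j)
  ...   | inj₁ sj<m = ≤-trans (≤-reflexive (build-< A D Y bs sj<m))
          (≤-trans (+-monoʳ-≤ Y (∸-monoʳ-≤ D (mono a j))) (≤-reflexive (sym (build-< A D Y bs j<m))))
  -- Here j is the last column and `suc j` opens the next block, so Y is compared with the next X.
  ...   | inj₂ (i , q) = begin
      at ν (suc j)  ≡⟨ cong (at ν) {suc j} {m + 0} (trans (cong suc j≡M) (sym (+-identityʳ m))) ⟩
      at ν (m + 0)  ≡⟨ trans (build-+ A D Y bs 0) (build-0 (Admissible-tail a)) ⟩
      first bs      ≤⟨ first-tail≤ L ⟩
      Y             ≡⟨ sym (build-M a) ⟩
      at ν M        ≡⟨ cong (at ν) (sym j≡M) ⟩
      at ν j        ∎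
    where
    open ≤-Reasoning
    ν = build A ((D , Y) ∷ bs)
    j≡M : j ≡ M
    j≡M = ≤-antisym (s≤s⁻¹ j<m) (s≤s⁻¹ (≤-trans (m≤m+n m i) (≤-reflexive (sym q))))

  build-mono : ∀ {n A bs} → LectureHall n bs → Admissible A bs → Mono (at (build A bs))
  build-mono lh0 a j = z≤n
  build-mono lh1 a = tail-mono lh1 a (λ _ → z≤n)
  build-mono L@(lh2 _ _ L′) a = tail-mono L a (build-mono L′ (Admissible-tail a))

  -- If A j < D, the first block absorbs the whole fall and the next block is still at its maximum
  -- in column j.
  next-entry : ∀ {A D Y bs} → Admissible A ((D , Y) ∷ bs) → ∀ j → j < m → A j < D →
    at (build (λ j → A j ∸ D) bs) j ≡ first bs
  next-entry {bs = []} a j j<m h = refl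
  next-entry {A} {D} {bs = (D₁ , Y₁) ∷ bs} a j j<m h =
    trans (build-< (λ j → A j ∸ D) D₁ Y₁ bs j<m)
      (trans (cong (λ z → Y₁ + (D₁ ∸ z)) (m≤n⇒m∸n≡0 (<⇒≤ h))) (+-comm Y₁ D₁))

  -- The converse of `build-blocks`. A general f allows the induction to pass to shifts and the
  -- result to be applied to the list without trailing zeros.
  build-spec : ∀ {n A bs f} → LectureHall n bs → Admissible A bs → (∀ j → f j ≡ at (build A bs) j) →
    Lecture n f × blocks n f ≡ bs × (∀ j → j < m → drops n f j ≡ A j)
  build-spec lh0 a q = q , refl , λ j j<m → sym (n≤0⇒n≡0 (Admissible-≤ a (s≤s⁻¹ j<m)))
  build-spec {1} {A} {f = f} (lh1 {D}) a q = fM , cong₂ (λ x y → (x , y) ∷ []) (cong₂ _∸_ f0 fM) fM , λ j j<m →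
      trans (cong₂ _∸_ f0 (trans (q j) (build-< A D 0 [] j<m)))
        (m∸[m∸n]≡n (≤-trans (Admissible-≤ a (s≤s⁻¹ j<m)) (≤-reflexive (+-identityʳ D))))
    where
    f0 : f 0 ≡ D
    f0 = trans (q 0) (trans (build-0 a) (+-identityʳ D))
    fM : f M ≡ 0
    fM = trans (q M) (build-M a)
  build-spec {A = A} {f = f} (lh2 {k} {D} {Y} {bs} h₁ h₂ L) a q =
      (R₁ , R₂ , R₃ , proj₁ IH)
    , cong₂ _∷_ (cong₂ _,_ D≡ fM) (proj₁ (proj₂ IH))
    , λ j j<m → trans (cong₂ _+_ (cong₂ _∸_ f0 (fj j<m)) (proj₂ (proj₂ IH) j j<m)) (split (A j))
    where
    f0 : f 0 ≡ D + Y
    f0 = trans (q 0) (build-0 a)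
    fM : f M ≡ Y
    fM = trans (q M) (build-M a)
    fj : ∀ {j} → j < m → f j ≡ Y + (D ∸ A j)
    fj {j} j<m = trans (q j) (build-< A D Y bs j<m)
    next : ∀ j → f (m + j) ≡ at (build (λ j → A j ∸ D) bs) j
    next j = trans (q (m + j)) (build-+ A D Y bs j)
    fm : f m ≡ first bs
    fm = trans (cong f (sym (+-identityʳ m))) (trans (next 0) (build-0 (Admissible-tail a)))
    IH = build-spec L (Admissible-tail a) next
    D≡ : f 0 ∸ f M ≡ D
    D≡ = trans (cong₂ _∸_ f0 fM) (m+n∸n≡m D Y)
    R₁ : f M * (2 + k) ≤ f 0 * (1 + k)
    R₁ rewrite f0 | fM = begin
      Y * (2 + k)              ≡⟨ *-suc Y (suc k) ⟩
      Y + Y * suc k            ≤⟨ +-monoˡ-≤ (Y * suc k) h₁ ⟩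
      suc k * D + Y * suc k    ≡⟨ cong (_+ Y * suc k) (*-comm (suc k) D) ⟩
      D * suc k + Y * suc k    ≡⟨ sym (*-distribʳ-+ (suc k) D Y) ⟩
      (D + Y) * (1 + k)        ∎
      where open ≤-Reasoning
    R₂ : f m * (1 + k) ≤ f M * k
    R₂ rewrite fm | fM | *-comm (first bs) (suc k) | *-comm Y k = h₂
    R₃ : ∀ j → j < m → f M < f j → f (m + j) ≡ f m
    R₃ j j<m h = trans (trans (next j) (next-entry a j j<m (positive (subst₂ _<_ fM (fj j<m) h)))) (sym fm)
      where
      positive : Y < Y + (D ∸ A j) → A j < D
      positive h = ≰⇒> λ D≤ → contradiction (subst (λ z → Y < Y + z) (m≤n⇒m∸n≡0 D≤) h) (<-irrefl (sym (+-identityʳ Y)))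
    -- The first difference is the smaller of x and D; the second is what remains of x.
    split : ∀ x → D + Y ∸ (Y + (D ∸ x)) + (x ∸ D) ≡ x
    split x with ≤-total x D
    ... | inj₁ x≤D rewrite m≤n⇒m∸n≡0 x≤D = trans (+-identityʳ _) (trans (cong (_∸ (Y + (D ∸ x))) (+-comm D Y))
            (trans ([m+n]∸[m+o]≡n∸o Y D (D ∸ x)) (m∸[m∸n]≡n x≤D)))
    ... | inj₂ D≤x rewrite m≤n⇒m∸n≡0 D≤x | +-identityʳ Y = trans (cong (_+ (x ∸ D)) (m+n∸n≡m D Y)) (m+[n∸m]≡n D≤x)

  -- In column j the blocks together exceed their minima by `sumD bs ∸ A j`: each unit of fall is
  -- absorbed by exactly one block as long as some D is left.
  build-sum : ∀ A bs → sum (build A bs) ≡ m * sumY bs + sum (applyUpTo (λ j → sumD bs ∸ A j) m)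
  build-sum A [] = sym (trans (cong₂ _+_ (*-zeroʳ m)
    (trans (cong sum (applyUpTo-cong m (λ j _ → 0∸n≡0 (A j)))) (sum-applyUpTo-const 0 m))) (*-zeroʳ m))
  build-sum A ((D , Y) ∷ bs) = begin
    sum (applyUpTo (λ j → Y + (D ∸ A j)) m ++ build A′ bs)
      ≡⟨ sum-++ (applyUpTo (λ j → Y + (D ∸ A j)) m) (build A′ bs) ⟩
    sum (applyUpTo (λ j → Y + (D ∸ A j)) m) + sum (build A′ bs)
      ≡⟨ cong₂ _+_ (trans (sum-applyUpTo-+ (λ _ → Y) (λ j → D ∸ A j) m)
           (cong (_+ S₁) (sum-applyUpTo-const Y m))) (build-sum A′ bs) ⟩
    m * Y + S₁ + (m * sumY bs + S₂)
      ≡⟨ eq m Y (sumY bs) S₁ S₂ ⟩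
    m * (Y + sumY bs) + (S₁ + S₂)
      ≡⟨ cong (m * (Y + sumY bs) +_) (trans (sym (sum-applyUpTo-+ (λ j → D ∸ A j) (λ j → sumD bs ∸ A′ j) m))
           (cong sum (applyUpTo-cong m (λ j _ → split (A j))))) ⟩
    m * (Y + sumY bs) + sum (applyUpTo (λ j → D + sumD bs ∸ A j) m) ∎
    where
    open ≡-Reasoning
    A′ = λ j → A j ∸ D
    S₁ = sum (applyUpTo (λ j → D ∸ A j) m)
    S₂ = sum (applyUpTo (λ j → sumD bs ∸ A′ j) m)
    eq : ∀ m Y Z a b → m * Y + a + (m * Z + b) ≡ m * (Y + Z) + (a + b)
    eq = solve-∀
    split : ∀ x → D ∸ x + (sumD bs ∸ (x ∸ D)) ≡ D + sumD bs ∸ x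
    split x with ≤-total x D
    ... | inj₁ x≤D rewrite m≤n⇒m∸n≡0 x≤D = sym (+-∸-comm (sumD bs) x≤D)
    ... | inj₂ D≤x rewrite m≤n⇒m∸n≡0 D≤x =
      trans (sym ([m+n]∸[m+o]≡n∸o D (sumD bs) (x ∸ D))) (cong (D + sumD bs ∸_) (m+[n∸m]≡n D≤x))

-- The conditions defining L

∧-split : ∀ {x y} → T (x ∧ y) → T x × T y
∧-split = Equivalence.to T-∧

∧-join : ∀ {x y} → T x → T y → T (x ∧ y)
∧-join p q = Equivalence.from T-∧ (p , q)

allᵇ⁻ : ∀ {A : Set} (p : A → Bool) xs → T (allᵇ p xs) → All (T ∘ p) xs
allᵇ⁻ p []       _ = []
allᵇ⁻ p (x ∷ xs) h with ∧-split {p x} h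
... | a , b = a ∷ allᵇ⁻ p xs b

allᵇ⁺ : ∀ {A : Set} (p : A → Bool) {xs} → All (T ∘ p) xs → T (allᵇ p xs)
allᵇ⁺ p []       = _
allᵇ⁺ p (a ∷ as) = ∧-join a (allᵇ⁺ p as)

allᵇ-upTo⁻ : ∀ p L → T (allᵇ p (upTo L)) → ∀ i → i < L → T (p i)
allᵇ-upTo⁻ p L h i i<L = All.applyUpTo⁻ (λ i → i) L (allᵇ⁻ p (upTo L) h) i<L

allᵇ-upTo⁺ : ∀ p L → (∀ i → i < L → T (p i)) → T (allᵇ p (upTo L))
allᵇ-upTo⁺ p L h = allᵇ⁺ p (All.applyUpTo⁺₁ (λ i → i) L (λ {i} → h i))

part-at : ∀ μ j → part μ (suc j) ≡ at μ j
part-at []       j       = refl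
part-at (x ∷ μ)  zero    = refl
part-at (x ∷ μ)  (suc j) = part-at μ j

part-+ : ∀ μ a j → part μ (a + suc j) ≡ at μ (a + j)
part-+ μ a j = trans (cong (part μ) (+-suc a j)) (part-at μ (a + j))

nonincr⇒mono : ∀ μ → T (nonincr μ) → Mono (at μ)
nonincr⇒mono []          h j       = z≤n
nonincr⇒mono (x ∷ [])    h j       = z≤n
nonincr⇒mono (x ∷ y ∷ μ) h zero    = ≤ᵇ⇒≤ y x (proj₁ (∧-split {y ≤ᵇ x} h))
nonincr⇒mono (x ∷ y ∷ μ) h (suc j) = nonincr⇒mono (y ∷ μ) (proj₂ (∧-split {y ≤ᵇ x} h)) j

mono⇒nonincr : ∀ μ → Mono (at μ) → T (nonincr μ)
mono⇒nonincr []          h = _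
mono⇒nonincr (x ∷ [])    h = _
mono⇒nonincr (x ∷ y ∷ μ) h = ∧-join (≤⇒≤ᵇ (h 0)) (mono⇒nonincr (y ∷ μ) (h ∘ suc))

at-beyond : ∀ μ {j} → length μ ≤ j → at μ j ≡ 0
at-beyond []      _       = refl
at-beyond (x ∷ μ) (s≤s h) = at-beyond μ h

Positive : List ℕ → Set
Positive = All (0 <_)

length-bound : ∀ {μ} → Positive μ → ∀ b → at μ b ≡ 0 → length μ ≤ b
length-bound []       b       _ = z≤n
length-bound (p ∷ ps) zero    q = contradiction (subst (0 <_) q p) λ ()
length-bound (p ∷ ps) (suc b) q = s≤s (length-bound ps b q)

largestIn-≥ : ∀ p k {j} → suc j ≤ k → T (p (suc j)) → suc j ≤ largestIn p k
largestIn-≥ p (suc k) {j} h t with p (suc k) in eq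
... | true  = h
... | false with m≤n⇒m<n∨m≡n h
...   | inj₁ (s≤s h′) = largestIn-≥ p k h′ t
...   | inj₂ refl     = contradiction (subst T eq t) λ ()

Largest : (ℕ → Bool) → ℕ → Set
Largest p k = largestIn p k ≡ 0 ⊎ (∃ λ j → largestIn p k ≡ suc j × suc j ≤ k × T (p (suc j)))

largestIn-spec : ∀ p k → Largest p k
largestIn-spec p zero = inj₁ refl
largestIn-spec p (suc k) with p (suc k) in eq
... | true  = inj₂ (k , refl , ≤-refl , subst T (sym eq) _)
... | false with largestIn-spec p k
...   | inj₁ z              = inj₁ z
...   | inj₂ (j , q , h , t) = inj₂ (j , q , m≤n⇒m≤1+n h , t)

-- Stated from 3 on because `chainLen 0` is truncated to 0, so that the chain gains only one step
-- from n = 0 to n = 2.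
chainLen-step : ∀ k → chainLen (3 + k) ≡ 2 + chainLen (1 + k)
chainLen-step k with ((1 + k) % 2) ≡ᵇ 0
... | true  = refl
... | false = refl

half-step : ∀ k → (2 + k) / 2 ≡ suc (k / 2)
half-step k = m/n≡1+[m∸n]/n {2 + k} {2} (s≤s (s≤s z≤n))

module Conditions (M′ : ℕ) where

  M : ℕ
  M = suc M′

  open Modulus M

  index : ℕ → ℕ
  index 0             = 0
  index 1             = M
  index (suc (suc r)) = m + index r

  pos-index : ∀ r → pos m r ≡ suc (index r)
  pos-index 0 = refl
  pos-index 1 = *-identityˡ m
  pos-index (suc (suc r)) with r % 2 ≡ᵇ 0 | pos-index r
  ... | true  | IH rewrite half-step r = trans (+-assoc m (r / 2 * m) 1) (trans (cong (m +_) IH) (+-suc m (index r)))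
  ... | false | IH = trans (cong (_* m) (half-step (r + 1))) (trans (cong (m +_) IH) (+-suc m (index r)))

  Chain : ℕ → (ℕ → ℕ) → Set
  Chain n f = ∀ r → r < chainLen n → f (index (suc r)) * (n ∸ r) ≤ f (index r) * (n ∸ suc r)

  cond2⇒chain : ∀ n μ → T (cond2 m n μ) → Chain n (at μ)
  cond2⇒chain n μ h r r< = subst₂ (λ x y → x * (n ∸ r) ≤ y * (n ∸ suc r)) (part-index (suc r)) (part-index r)
      (≤ᵇ⇒≤ _ _ (allᵇ-upTo⁻ _ (chainLen n) h r r<))
    where part-index : ∀ r → part μ (pos m r) ≡ at μ (index r)
          part-index r = trans (cong (part μ) (pos-index r)) (part-at μ (index r))

  chain⇒cond2 : ∀ n μ → Chain n (at μ) → T (cond2 m n μ)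
  chain⇒cond2 n μ h = allᵇ-upTo⁺ _ (chainLen n) λ r r< →
      ≤⇒≤ᵇ (subst₂ (λ x y → x * (n ∸ r) ≤ y * (n ∸ suc r)) (sym (part-index (suc r))) (sym (part-index r)) (h r r<))
    where part-index : ∀ r → part μ (pos m r) ≡ at μ (index r)
          part-index r = trans (cong (part μ) (pos-index r)) (part-at μ (index r))

  -- lb_i ≤ fb_{i+1}, for every i: a part above the minimum of its block sits over a maximal part of the next block.
  Columns : (ℕ → ℕ) → Set
  Columns f = ∀ i j → j < m → f (i * m + M) < f (i * m + j) → f (suc i * m + j) ≡ f (suc i * m)

  block-end : ∀ μ i → part μ (i * m + m) ≡ at μ (i * m + M)
  block-end μ i = part-+ μ (i * m) M

  block-start : ∀ μ i → part μ (i * m + 1) ≡ at μ (i * m)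
  block-start μ i = trans (part-+ μ (i * m) 0) (cong (at μ) (+-identityʳ (i * m)))

  fbᵇ lbᵇ : List ℕ → ℕ → ℕ → Bool
  fbᵇ μ i j = part μ (i * m + j) ≡ᵇ part μ (i * m + 1)
  lbᵇ μ i j = part μ (i * m + m) <ᵇ part μ (i * m + j)

  -- A column j above the minimum gives j + 1 ≤ lb_i ≤ fb_{i+1}, so block i + 1 is constant up to
  -- column j by monotonicity. For i beyond the range of (1), block i + 1 consists of zeros.
  cond1⇒columns : ∀ μ → Mono (at μ) → T (cond1 m μ) → Columns (at μ)
  cond1⇒columns μ mono h i j j<m f< with <-≤-connex i ((length μ ∸ 1) / m)
  ... | inj₁ i< = ≤-antisym (mono-≤ mono (m≤m+n (suc i * m) j)) (from (largestIn-spec (fbᵇ μ (suc i)) m))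
    where
    lb≥ : suc j ≤ lb m μ i
    lb≥ = largestIn-≥ (lbᵇ μ i) m j<m (<⇒<ᵇ (subst₂ _<_ (sym (block-end μ i)) (sym (part-+ μ (i * m) j)) f<))
    fb≥ : suc j ≤ fb m μ (suc i)
    fb≥ = ≤-trans lb≥ (≤ᵇ⇒≤ _ _ (allᵇ-upTo⁻ _ ((length μ ∸ 1) / m) h i i<))
    from : Largest (fbᵇ μ (suc i)) m → at μ (suc i * m) ≤ at μ (suc i * m + j)
    from (inj₁ z) = contradiction (≤-trans fb≥ (≤-reflexive z)) λ ()
    from (inj₂ (j′ , q , _ , t)) = begin
      at μ (suc i * m)             ≡⟨ sym (block-start μ (suc i)) ⟩
      part μ (suc i * m + 1)       ≡⟨ sym (≡ᵇ⇒≡ _ _ t) ⟩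
      part μ (suc i * m + suc j′)  ≡⟨ part-+ μ (suc i * m) j′ ⟩
      at μ (suc i * m + j′)        ≤⟨ mono-≤ mono (+-monoʳ-≤ (suc i * m) (s≤s⁻¹ (≤-trans fb≥ (≤-reflexive q)))) ⟩
      at μ (suc i * m + j)         ∎
      where open ≤-Reasoning
  ... | inj₂ i≥ = trans (at-beyond μ (≤-trans len≤ (m≤m+n (suc i * m) j))) (sym (at-beyond μ len≤))
    where
    len≤ : length μ ≤ suc i * m
    len≤ = ≤-trans (n≤1+pred (length μ)) (begin-strict
      pred (length μ)                              ≡⟨ m≡m%n+[m/n]*n (length μ ∸ 1) m ⟩
      (length μ ∸ 1) % m + (length μ ∸ 1) / m * m  <⟨ +-mono-<-≤ (m%n<n (length μ ∸ 1) m) (*-monoˡ-≤ m i≥) ⟩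
      m + i * m                                    ∎)
      where open ≤-Reasoning
            n≤1+pred : ∀ n → n ≤ suc (pred n)
            n≤1+pred zero    = z≤n
            n≤1+pred (suc n) = ≤-refl

  columns⇒cond1 : ∀ μ → Columns (at μ) → T (cond1 m μ)
  columns⇒cond1 μ C = allᵇ-upTo⁺ _ ((length μ ∸ 1) / m) λ i _ → ≤⇒≤ᵇ (from i (largestIn-spec (lbᵇ μ i) m))
    where
    from : ∀ i → Largest (lbᵇ μ i) m → lb m μ i ≤ fb m μ (suc i)
    from i (inj₁ z) = ≤-trans (≤-reflexive z) z≤n
    from i (inj₂ (j , q , j<m , t)) = ≤-trans (≤-reflexive q) (largestIn-≥ (fbᵇ μ (suc i)) m j<m (≡⇒≡ᵇ _ _
      (trans (part-+ μ (suc i * m) j) (trans (C i j j<m (subst₂ _<_ (block-end μ i) (part-+ μ (i * m) j) (<ᵇ⇒< _ _ t))) (sym (block-start μ (suc i)))))))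

  Columns-shift : ∀ {f} → Columns f → Columns (shift f)
  Columns-shift {f} C i j j<m h = trans (cong f (sym (+-assoc m (suc i * m) j)))
    (C (suc i) j j<m (subst₂ (λ x y → f x < f y) (sym (+-assoc m (i * m) M)) (sym (+-assoc m (i * m) j)) h))

  maxLength : ℕ → ℕ
  maxLength n = ((n + 1) / 2) * (m ∸ 2) + n

  -- Two more levels contribute (m - 2) + 2 places, one full block.
  maxLength-step : ∀ k → maxLength (2 + k) ≡ m + maxLength k
  maxLength-step k rewrite half-step (k + 1) = eq ((k + 1) / 2) M′ k
    where eq : ∀ h x k → (x + h * x) + (2 + k) ≡ 2 + x + (h * x + k)
          eq = solve-∀

  Support : ℕ → (ℕ → ℕ) → Set
  Support n f = ∀ j → maxLength n ≤ j → f j ≡ 0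

  Support-shift : ∀ {k f} → Support (2 + k) f → Support k (shift f)
  Support-shift {k} S j h = S (m + j) (≤-trans (≤-reflexive (maxLength-step k)) (+-monoʳ-≤ m h))

  Chain-shift : ∀ {k f} → Chain (2 + k) f → Chain k (shift f)
  Chain-shift {zero} C r ()
  Chain-shift {suc k} C r h = C (2 + r) (≤-trans (s≤s (s≤s h)) (≤-reflexive (sym (chainLen-step k))))

  chainLen≥1 : ∀ k → 1 ≤ chainLen (2 + k)
  chainLen≥1 k with k % 2 ≡ᵇ 0
  ... | true  = s≤s z≤n
  ... | false = s≤s z≤n

  -- The length bound settles the bottom: it gives the final zero at level 1, and at level 2, where
  -- the chain stops at the end of the block, it makes the next entry 0.
  conditions⇒Lecture : ∀ n {f} → Columns f → Chain n f → Support n f → Lecture n f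
  conditions⇒Lecture 0 C H S = λ j → S j z≤n
  conditions⇒Lecture 1 C H S = S M (≤-reflexive (trans (cong (_+ 1) (+-identityʳ M′)) (+-comm M′ 1)))
  conditions⇒Lecture (suc (suc k)) {f} C H S =
      H 0 (chainLen≥1 k)
    , second k H S
    , (λ j j<m h → trans (cong (λ z → f (z + j)) (sym (*-identityˡ m))) (trans (C 0 j j<m h) (cong f (*-identityˡ m))))
    , conditions⇒Lecture k (Columns-shift {f} C) (Chain-shift {k} {f} H) (Support-shift {k} {f} S)
    where
    second : ∀ k → Chain (2 + k) f → Support (2 + k) f → f m * (1 + k) ≤ f M * k
    second zero    H S = ≤-trans (≤-reflexive (cong (_* 1) (S m (≤-reflexive (trans (maxLength-step 0) (+-identityʳ m)))))) z≤n
    second (suc k) H S = subst (λ z → f z * (2 + k) ≤ f M * (1 + k)) (+-identityʳ m)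
      (H 1 (≤-trans (s≤s (s≤s z≤n)) (≤-reflexive (sym (chainLen-step k)))))

  Lecture⇒columns : ∀ n {f} → Mono f → Lecture n f → Columns f
  Lecture⇒columns 0 h R i j j<m p = trans (R _) (sym (R _))
  Lecture⇒columns 1 {f} h R i j j<m p = trans (zero-from (≤-trans M≤ (m≤m+n (suc i * m) j))) (sym (zero-from M≤))
    where
    zero-from : ∀ {x} → M ≤ x → f x ≡ 0
    zero-from h′ = n≤0⇒n≡0 (≤-trans (mono-≤ h h′) (≤-reflexive R))
    M≤ : M ≤ suc i * m
    M≤ = ≤-trans (n≤1+n M) (m≤m+n m (i * m))
  Lecture⇒columns (suc (suc k)) {f} h (_ , _ , R₃ , _) zero j j<m p =
    trans (cong (λ z → f (z + j)) (*-identityˡ m)) (trans (R₃ j j<m p) (cong f (sym (*-identityˡ m))))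
  Lecture⇒columns (suc (suc k)) {f} h (_ , _ , _ , R) (suc i) j j<m p =
    trans (cong f (+-assoc m (suc i * m) j))
      (Lecture⇒columns k (Mono-shift h) R i j j<m (subst₂ (λ x y → f x < f y) (+-assoc m (i * m) M) (+-assoc m (i * m) j) p))

  Lecture⇒chain : ∀ n {f} → Lecture n f → Chain n f
  Lecture⇒chain 0 R r ()
  Lecture⇒chain 1 {f} R zero    _ = ≤-reflexive (trans (cong (_* 1) R) (sym (*-zeroʳ (f 0))))
  Lecture⇒chain 1 R (suc r) (s≤s ())
  Lecture⇒chain (suc (suc k)) (R₁ , _ , _ , _) 0 _ = R₁
  Lecture⇒chain (suc (suc k)) {f} (_ , R₂ , _ , _) 1 _ = subst (λ z → f z * (1 + k) ≤ f M * k) (sym (+-identityʳ m)) R₂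
  Lecture⇒chain 2 R (suc (suc r)) (s≤s ())
  Lecture⇒chain (suc (suc (suc k))) (_ , _ , _ , R) (suc (suc r)) h =
    Lecture⇒chain (suc k) R r (s≤s⁻¹ (s≤s⁻¹ (≤-trans h (≤-reflexive (chainLen-step k)))))

  Lecture⇒end : ∀ n {f} → Lecture n f → f (maxLength n) ≡ 0
  Lecture⇒end 0 R = R _
  Lecture⇒end 1 {f} R = trans (cong f (trans (cong (_+ 1) (+-identityʳ M′)) (+-comm M′ 1))) R
  Lecture⇒end (suc (suc k)) {f} (_ , _ , _ , R) = trans (cong f (maxLength-step k)) (Lecture⇒end k R)

  -- This yields the multiplicity bound of `inD`. The ratios make positive entries fall strictly
  -- from X to Y and from Y to the next X. From column 0, M places lead to Y; from any later column
  -- they lead into the next block.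
  Lecture⇒gap : ∀ n {f} → Mono f → Lecture n f → ∀ j → 0 < f j → f (j + M) < f j
  Lecture⇒gap 0 h R j p = contradiction (subst (0 <_) (R j) p) λ ()
  Lecture⇒gap 1 h R j p = ≤-<-trans (≤-trans (mono-≤ h (m≤n+m M j)) (≤-reflexive R)) p
  Lecture⇒gap (suc (suc k)) {f} h (R₁ , R₂ , _ , R) j p with split-index m j
  ... | inj₂ (i , refl) = ≤-<-trans (≤-reflexive (cong f (+-assoc m i M))) (Lecture⇒gap k (Mono-shift h) R i p)
  Lecture⇒gap (suc (suc k)) {f} h (R₁ , R₂ , _ , R) zero p | inj₁ _ =
    ≰⇒> λ q → contradiction (subst (0 <_) (ratio-zero k (f 0) (≤-trans (*-monoˡ-≤ (2 + k) q) R₁)) p) λ ()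
  Lecture⇒gap (suc (suc k)) {f} h (R₁ , R₂ , _ , R) (suc j) p | inj₁ j<m =
    ≤-<-trans (mono-≤ h (s≤s (m≤n+m M j))) (below (f M) refl)
    where
    below : ∀ y → f M ≡ y → f m < f (suc j)
    below zero    q = ≤-<-trans (≤-trans (h M) (≤-reflexive q)) p
    below (suc y) q = <-≤-trans (≰⇒> λ r → <⇒≱ (*-monoʳ-< (suc y) (n<1+n k))
        (≤-trans (*-monoˡ-≤ (1 + k) (≤-trans (≤-reflexive (sym q)) r)) (subst (λ z → f m * (1 + k) ≤ z * k) q R₂)))
      (mono-≤ h (s≤s⁻¹ j<m))

occ-< : ∀ {x} μ k → Mono (at μ) → at μ k < x → occ x μ ≤ k
occ-< []      k       h p = z≤n
occ-< {x} (y ∷ μ) k h p with x ≡ᵇ y in eq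
occ-< {x} (y ∷ μ) zero    h p | true  = contradiction (≡ᵇ⇒≡ x y (subst T (sym eq) _)) (<⇒≢ p ∘ sym)
occ-< {x} (y ∷ μ) (suc k) h p | true  = s≤s (occ-< μ k (h ∘ suc) p)
occ-< {x} (y ∷ μ) zero    h p | false = occ-< μ 0 (h ∘ suc) (≤-<-trans (h 0) p)
occ-< {x} (y ∷ μ) (suc k) h p | false = m≤n⇒m≤1+n (occ-< μ k (h ∘ suc) p)

-- At the first copy of x the gap puts every entry from M places on below x, so all copies lie among
-- M consecutive entries.
occ-gap : ∀ {x} M μ → Mono (at μ) → (∀ j → 0 < at μ j → at μ (j + M) < at μ j) → 0 < x → occ x μ ≤ M
occ-gap M [] h g p = z≤n
occ-gap {x} M (y ∷ μ) h g p with x ≟ y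
... | yes refl = occ-< (y ∷ μ) M h (g 0 p)
... | no x≢y with x ≡ᵇ y in eq
...   | true  = contradiction (≡ᵇ⇒≡ x y (subst T (sym eq) _)) x≢y
...   | false = occ-gap M μ (h ∘ suc) (g ∘ suc) p

eqVecᵇ⁻ : ∀ {k} (g : ℕ → ℕ) (a : Vec ℕ k) → T (eqVecᵇ (tabulate (g ∘ toℕ)) a) → ∀ j → j < k → g j ≡ at (toList a) j
eqVecᵇ⁻ g (x Vec.∷ a) h zero    _       = ≡ᵇ⇒≡ (g 0) x (proj₁ (∧-split {g 0 ≡ᵇ x} h))
eqVecᵇ⁻ g (x Vec.∷ a) h (suc j) (s≤s p) = eqVecᵇ⁻ (g ∘ suc) a (proj₂ (∧-split {g 0 ≡ᵇ x} h)) j p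

eqVecᵇ⁺ : ∀ {k} (g : ℕ → ℕ) (a : Vec ℕ k) → (∀ j → j < k → g j ≡ at (toList a) j) → T (eqVecᵇ (tabulate (g ∘ toℕ)) a)
eqVecᵇ⁺ g Vec.[]      h = _
eqVecᵇ⁺ g (x Vec.∷ a) h = ∧-join (≡⇒≡ᵇ (g 0) x (h 0 (s≤s z≤n))) (eqVecᵇ⁺ (g ∘ suc) a (λ j p → h (suc j) (s≤s p)))

-- `build` may end in zeros, whereas partitions list nonzero parts only; a monotone list loses
-- nothing else when cut at its first zero.
strip : List ℕ → List ℕ
strip []          = []
strip (zero ∷ _)  = []
strip (suc x ∷ ν) = suc x ∷ strip ν

strip-positive : ∀ ν → Positive (strip ν)
strip-positive []          = []
strip-positive (zero ∷ _)  = []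
strip-positive (suc x ∷ ν) = s≤s z≤n ∷ strip-positive ν

at-strip : ∀ ν → Mono (at ν) → ∀ j → at (strip ν) j ≡ at ν j
at-strip []          h j       = refl
at-strip (zero ∷ ν)  h j       = sym (n≤0⇒n≡0 (mono-≤ h {0} {j} z≤n))
at-strip (suc x ∷ ν) h zero    = refl
at-strip (suc x ∷ ν) h (suc j) = at-strip ν (h ∘ suc) j

sum-zero : ∀ ν → (∀ j → at ν j ≡ 0) → sum ν ≡ 0
sum-zero []      h = refl
sum-zero (x ∷ ν) h = cong₂ _+_ (h 0) (sum-zero ν (h ∘ suc))

sum-strip : ∀ ν → Mono (at ν) → sum (strip ν) ≡ sum ν
sum-strip []          h = refl
sum-strip (zero ∷ ν)  h = sym (sum-zero ν (λ j → n≤0⇒n≡0 (mono-≤ h {0} {suc j} z≤n)))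
sum-strip (suc x ∷ ν) h = cong (suc x +_) (sum-strip ν (h ∘ suc))

at-injective : ∀ {μ ν} → Positive μ → Positive ν → (∀ j → at μ j ≡ at ν j) → μ ≡ ν
at-injective []       []       h = refl
at-injective []       (q ∷ qs) h = contradiction (subst (0 <_) (sym (h 0)) q) λ ()
at-injective (p ∷ ps) []       h = contradiction (subst (0 <_) (h 0) p) λ ()
at-injective (p ∷ ps) (q ∷ qs) h = cong₂ _∷_ (h 0) (at-injective ps qs (h ∘ suc))

-- α j is the multiplicity of the residue j + 1.
psum : (ℕ → ℕ) → ℕ → ℕ
psum α zero    = 0
psum α (suc j) = psum α j + α j

-- A bijection between two predicates. The maps are total and the laws are required only on the
-- predicates, so the data carries no proofs.
record _≃_ {A B : Set} (P : A → Set) (Q : B → Set) : Set where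
  field
    to      : A → B
    from    : B → A
    to-∈    : ∀ {x} → P x → Q (to x)
    from-∈  : ∀ {y} → Q y → P (from y)
    from∘to : ∀ {x} → P x → from (to x) ≡ x
    to∘from : ∀ {y} → Q y → to (from y) ≡ y

-- Coding the partitions in L by blocks

module LSide (M′ : ℕ) where

  open Conditions M′
  open Modulus M

  columnSum : ℕ → (ℕ → ℕ) → ℕ → ℕ
  columnSum zero    f j = 0
  columnSum (suc L) f j = (f j ∸ f (suc j)) + columnSum L (shift f) j

  sum-columnSum : ∀ L g {f j} → (∀ t → g t ≡ f (t * m + j) ∸ f (suc (t * m + j))) → sum (applyUpTo g L) ≡ columnSum L f j
  sum-columnSum zero    g h = refl
  sum-columnSum (suc L) g {f} {j} h = cong₂ _+_ (h 0) (sum-columnSum L (g ∘ suc) λ t →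
    trans (h (suc t)) (cong₂ (λ x y → f x ∸ f y) (+-assoc m (t * m) j) (trans (cong suc (+-assoc m (t * m) j)) (sym (+-suc m (t * m + j))))))

  s-columnSum : ∀ μ j → s m (suc j) μ ≡ columnSum (suc (length μ)) (at μ) j
  s-columnSum μ j = trans (cong sum (map-upTo g (suc (length μ)))) (sum-columnSum (suc (length μ)) g {at μ} λ t →
      cong₂ _∸_ (part-+ μ (t * m) j)
        (trans (cong (part μ) (trans (+-comm (t * m + suc j) 1) (cong suc (+-suc (t * m) j)))) (part-at μ (suc (t * m + j)))))
    where g = λ t → part μ (t * m + suc j) ∸ part μ (t * m + suc j + 1)

  columnDrops : ℕ → (ℕ → ℕ) → ℕ → ℕ
  columnDrops 0 f j = 0
  columnDrops 1 f j = f j ∸ f (suc j)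
  columnDrops (suc (suc k)) f j = (f j ∸ f (suc j)) + columnDrops k (shift f) j

  columnDrops-zero : ∀ n {f} → (∀ j → f j ≡ 0) → ∀ j → columnDrops n f j ≡ 0
  columnDrops-zero 0 h j = refl
  columnDrops-zero 1 {f} h j = cong₂ _∸_ (h j) (h (suc j))
  columnDrops-zero (suc (suc k)) h j = cong₂ _+_ (cong₂ _∸_ (h j) (h (suc j))) (columnDrops-zero k (λ i → h (m + i)) j)

  columnSum-zero : ∀ L {f} → (∀ j → f j ≡ 0) → ∀ j → columnSum L f j ≡ 0
  columnSum-zero zero    h j = refl
  columnSum-zero (suc L) h j = cong₂ _+_ (cong₂ _∸_ (h j) (h (suc j))) (columnSum-zero L (λ i → h (m + i)) j)

  -- The sum defining s_j runs over l(μ) + 1 blocks, `columnDrops` over the blocks of level n. Past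
  -- the end of either range all entries are 0.
  columnSum≡columnDrops : ∀ n {f} L → Mono f → Lecture n f → (∀ j → L ≤ j → f j ≡ 0) → ∀ j →
    columnSum (suc L) f j ≡ columnDrops n f j
  columnSum≡columnDrops 0 L h R z j = columnSum-zero (suc L) R j
  columnSum≡columnDrops 1 {f} L h R z j = trans (cong (f j ∸ f (suc j) +_) (columnSum-zero L
    (λ i → n≤0⇒n≡0 (≤-trans (mono-≤ h (≤-trans (n≤1+n M) (m≤m+n m i))) (≤-reflexive R))) j)) (+-identityʳ _)
  columnSum≡columnDrops (suc (suc k)) {f} zero h R z j =
    cong (f j ∸ f (suc j) +_) (sym (columnDrops-zero k (λ i → z (m + i) z≤n) j))
  columnSum≡columnDrops (suc (suc k)) {f} (suc L) h (_ , _ , _ , R) z j =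
    cong (f j ∸ f (suc j) +_) (columnSum≡columnDrops k L (Mono-shift h) R
      (λ i L≤i → z (m + i) (s≤s (≤-trans L≤i (m≤n+m i M)))) j)

  drops-0 : ∀ n f → drops n f 0 ≡ 0
  drops-0 0 f = refl
  drops-0 1 f = n∸n≡0 (f 0)
  drops-0 (suc (suc k)) f = cong₂ _+_ (n∸n≡0 (f 0)) (drops-0 k (shift f))

  drop-step : ∀ {f} → Mono f → ∀ j → f 0 ∸ f (suc j) ≡ (f 0 ∸ f j) + (f j ∸ f (suc j))
  drop-step {f} h j = trans (cong (_∸ f (suc j)) (sym (m∸n+n≡m (mono-≤ h {0} {j} z≤n)))) (+-∸-assoc (f 0 ∸ f j) (h j))

  -- The falls telescope in every block, which makes the drops prefix sums of the s_j.
  drops-suc : ∀ n {f} → Mono f → ∀ j → drops n f (suc j) ≡ drops n f j + columnDrops n f j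
  drops-suc 0 h j = refl
  drops-suc 1 h j = drop-step h j
  drops-suc (suc (suc k)) {f} h j = trans (cong₂ _+_ (drop-step h j) (drops-suc k (Mono-shift h) j))
      (eq (f 0 ∸ f j) (f j ∸ f (suc j)) (drops k (shift f) j) (columnDrops k (shift f) j))
    where eq : ∀ a b c d → (a + b) + (c + d) ≡ (a + c) + (b + d)
          eq = solve-∀

  psum-drops : ∀ n {f} α → Mono f → (∀ j → j < M → columnDrops n f j ≡ α j) → ∀ j → j < m → psum α j ≡ drops n f j
  psum-drops n {f} α h q zero    _       = sym (drops-0 n f)
  psum-drops n {f} α h q (suc j) (s≤s p) =
    trans (cong₂ _+_ (psum-drops n α h q j (m≤n⇒m≤1+n p)) (sym (q j p))) (sym (drops-suc n h j))

  drops-psum : ∀ n {f} α → Mono f → (∀ j → j < m → psum α j ≡ drops n f j) → ∀ j → j < M → columnDrops n f j ≡ α j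
  drops-psum n {f} α h q j p = +-cancelˡ-≡ (psum α j) _ _ (trans (cong (_+ columnDrops n f j) (q j (m≤n⇒m≤1+n p)))
    (trans (sym (drops-suc n h j)) (sym (q (suc j) (s≤s p)))))

  Structured : ℕ → (ℕ → ℕ) → List ℕ → Set
  Structured n α μ = Lecture n (at μ) × (∀ j → j < m → psum α j ≡ drops n (at μ) j)

  s-columnDrops : ∀ n μ → Mono (at μ) → Lecture n (at μ) → ∀ j → s m (suc j) μ ≡ columnDrops n (at μ) j
  s-columnDrops n μ h R j = trans (s-columnSum μ j) (columnSum≡columnDrops n (length μ) h R (λ _ → at-beyond μ) j)

  inL⇒structured : ∀ n μ (a : Vec ℕ M) → Mono (at μ) →
    T (inL m n μ ∧ eqVecᵇ (sVec m μ) a) → Structured n (at (toList a)) μ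
  inL⇒structured n μ a h t with ∧-split {inL m n μ} t
  ... | t₁ , t₂ with ∧-split {inD m μ} t₁
  ... | _ , t₃ with ∧-split {length μ ≤ᵇ maxLength n} t₃
  ... | t₄ , t₅ with ∧-split {cond1 m μ} t₅
  ... | t₆ , t₇ = R , psum-drops n (at (toList a)) h λ j p →
      trans (sym (s-columnDrops n μ h R j)) (eqVecᵇ⁻ (λ i → s m (suc i) μ) a t₂ j p)
    where
    R : Lecture n (at μ)
    R = conditions⇒Lecture n (cond1⇒columns μ h t₆) (cond2⇒chain n μ t₇)
          (λ j q → at-beyond μ (≤-trans (≤ᵇ⇒≤ (length μ) (maxLength n) t₄) q))

  structured⇒inL : ∀ n μ (a : Vec ℕ M) → Mono (at μ) → Positive μ →
    Structured n (at (toList a)) μ → T (inL m n μ ∧ eqVecᵇ (sVec m μ) a)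
  structured⇒inL n μ a h pos (R , q) = ∧-join
    (∧-join (allᵇ⁺ (λ x → occ x μ ≤ᵇ M) (All.map (λ p → ≤⇒≤ᵇ (occ-gap M μ h (Lecture⇒gap n h R) p)) pos))
      (∧-join (≤⇒≤ᵇ (length-bound pos (maxLength n) (Lecture⇒end n R)))
        (∧-join (columns⇒cond1 μ (Lecture⇒columns n h R)) (chain⇒cond2 n μ (Lecture⇒chain n R)))))
    (eqVecᵇ⁺ (λ i → s m (suc i) μ) a λ j p → trans (s-columnDrops n μ h R j) (drops-psum n (at (toList a)) h q j p))

  -- The sum of the residues, α j copies of j + 1 for each j < M, counted by columns.
  base : (ℕ → ℕ) → ℕ
  base α = sum (applyUpTo (λ j → psum α M ∸ psum α j) m)

  LParts : ℕ → (ℕ → ℕ) → ℕ → List ℕ → Set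
  LParts n α N μ = (Mono (at μ) × Positive μ × sum μ ≡ N) × Structured n α μ

  Halls : ℕ → (ℕ → ℕ) → ℕ → List Block → Set
  Halls n α N bs = LectureHall n bs × sumD bs ≡ psum α M × m * sumY bs + base α ≡ N

  psum-admissible : ∀ α {bs} → sumD bs ≡ psum α M → Admissible (psum α) bs
  psum-admissible α q = record { start = refl ; mono = λ j → m≤m+n (psum α j) (α j) ; total = sym q }

  build-weight : ∀ α bs → sumD bs ≡ psum α M → sum (build (psum α) bs) ≡ m * sumY bs + base α
  build-weight α bs q = trans (build-sum (psum α) bs)
    (cong (λ z → m * sumY bs + sum (applyUpTo (λ j → z ∸ psum α j) m)) q)

  -- The s_j fix the function A = `psum α`, so the blocks are the only remaining freedom.
  LParts≃Halls : ∀ n α N → LParts n α N ≃ Halls n α N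
  LParts≃Halls n α N = record
    { to      = λ μ → blocks n (at μ)
    ; from    = λ bs → strip (build (psum α) bs)
    ; to-∈    = to-∈
    ; from-∈  = from-∈
    ; from∘to = inverse
    ; to∘from = λ { {bs} (L , d , w) → let a = psum-admissible α d
                                       in proj₁ (proj₂ (build-spec L a (at-strip (build (psum α) bs) (build-mono L a)))) }
    }
    where
    ν : List ℕ → List ℕ
    ν μ = build (psum α) (blocks n (at μ))
    D≡ : ∀ {μ} → LParts n α N μ → sumD (blocks n (at μ)) ≡ psum α M
    D≡ {μ} (_ , R , q) = trans (blocks-sumD n (at μ)) (sym (q M (n<1+n M)))
    rebuilt : ∀ {μ} → LParts n α N μ → ∀ j → at (ν μ) j ≡ at μ j
    rebuilt ((h , _ , _) , R , q) = build-blocks n (psum α) h R q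
    rebuilt-mono : ∀ {μ} → LParts n α N μ → Mono (at (ν μ))
    rebuilt-mono p@((h , _) , _) j = subst₂ _≤_ (sym (rebuilt p (suc j))) (sym (rebuilt p j)) (h j)
    inverse : ∀ {μ} → LParts n α N μ → strip (ν μ) ≡ μ
    inverse {μ} p@((_ , pos , _) , _) =
      at-injective (strip-positive (ν μ)) pos λ j → trans (at-strip (ν μ) (rebuilt-mono p) j) (rebuilt p j)
    to-∈ : ∀ {μ} → LParts n α N μ → Halls n α N (blocks n (at μ))
    to-∈ {μ} p@((h , _ , w) , R , q) = blocks-lectureHall n h R , D≡ p , (begin
      -- The weight formula is known for built lists, so μ is replaced by its reconstruction.
      m * sumY (blocks n (at μ)) + base α  ≡⟨ sym (build-weight α (blocks n (at μ)) (D≡ p)) ⟩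
      sum (ν μ)                            ≡⟨ sym (sum-strip (ν μ) (rebuilt-mono p)) ⟩
      sum (strip (ν μ))                    ≡⟨ cong sum (inverse p) ⟩
      sum μ                                ≡⟨ w ⟩
      N                                    ∎)
      where open ≡-Reasoning
    from-∈ : ∀ {bs} → Halls n α N bs → LParts n α N (strip (build (psum α) bs))
    from-∈ {bs} (L , d , w) =
        ( (λ j → subst₂ _≤_ (sym (at-strip κ h (suc j))) (sym (at-strip κ h j)) (h j))
        , strip-positive κ
        , trans (sum-strip κ h) (trans (build-weight α bs d) w))
      , proj₁ spec , λ j p → sym (proj₂ (proj₂ spec) j p)
      where
      κ = build (psum α) bs
      h = build-mono L (psum-admissible α d)
      spec = build-spec L (psum-admissible α d) (at-strip κ h)

-- Quotients and residues

AllPairs-reverse : ∀ {R : ℕ → ℕ → Set} {xs} → AllPairs R xs → AllPairs (flip R) (reverse xs)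
AllPairs-reverse [] = []
AllPairs-reverse {R} {x ∷ xs} (r ∷ rs) = subst (AllPairs (flip R)) (sym (unfold-reverse x xs))
  (AllPairs.++⁺ (AllPairs-reverse rs) ([] ∷ []) (All.map (_∷ []) (All-resp-↭ (↭-sym (↭-reverse xs)) r)))

desc⇒mono : ∀ {xs} → AllPairs _≥_ xs → Mono (at xs)
desc⇒mono []                       j       = z≤n
desc⇒mono (_ ∷ [])                 j       = z≤n
desc⇒mono ((p ∷ _) ∷ (_ ∷ _))      zero    = p
desc⇒mono (_ ∷ s@(_ ∷ _))          (suc j) = desc⇒mono s j

at-all : ∀ {P : ℕ → Set} xs → (∀ j → P (at xs j)) → All P xs
at-all []       h = []
at-all (x ∷ xs) h = h 0 ∷ at-all xs (h ∘ suc)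

mono⇒desc : ∀ xs → Mono (at xs) → AllPairs _≥_ xs
mono⇒desc []       h = []
mono⇒desc (x ∷ xs) h = at-all xs (λ j → mono-≤ h {0} {suc j} z≤n) ∷ mono⇒desc xs (h ∘ suc)

sum-reverse : ∀ xs → sum (reverse xs) ≡ sum xs
sum-reverse xs = sum-↭ (↭-reverse xs)

all-reverse : ∀ {P : ℕ → Set} xs → All P xs → All P (reverse xs)
all-reverse xs = All-resp-↭ (↭-sym (↭-reverse xs))

residues : (ℕ → ℕ) → ℕ → List ℕ
residues α zero    = []
residues α (suc k) = replicate (α k) (suc k) ++ residues α k

residues-length : ∀ α k → length (residues α k) ≡ psum α k
residues-length α zero    = refl
residues-length α (suc k) = trans (length-++ (replicate (α k) (suc k)))
  (trans (cong₂ _+_ (length-replicate (α k)) (residues-length α k)) (+-comm (α k) (psum α k)))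

residues-range : ∀ α k → All (λ r → 0 < r × r ≤ k) (residues α k)
residues-range α zero    = []
residues-range α (suc k) = All.++⁺ (All.replicate⁺ (α k) (s≤s z≤n , ≤-refl))
  (All.map (λ (p , q) → p , m≤n⇒m≤1+n q) (residues-range α k))

residues-desc : ∀ α k → AllPairs _≥_ (residues α k)
residues-desc α zero    = []
residues-desc α (suc k) = AllPairs.++⁺ (const (α k)) (residues-desc α k)
    (All.replicate⁺ (α k) (All.map (λ (_ , q) → m≤n⇒m≤1+n q) (residues-range α k)))
  where
  const : ∀ c → AllPairs _≥_ (replicate c (suc k))
  const zero    = []
  const (suc c) = All.replicate⁺ c ≤-refl ∷ const c

sum-applyUpTo-suc : ∀ f n → sum (applyUpTo f (suc n)) ≡ sum (applyUpTo f n) + f n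
sum-applyUpTo-suc f zero    = +-identityʳ (f 0)
sum-applyUpTo-suc f (suc n) = trans (cong (f 0 +_) (sum-applyUpTo-suc (f ∘ suc) n)) (sym (+-assoc (f 0) _ _))

sum-replicate : ∀ c x → sum (replicate c x) ≡ c * x
sum-replicate zero    x = refl
sum-replicate (suc c) x = cong (x +_) (sum-replicate c x)

psum-mono : ∀ α {i j} → i ≤ j → psum α i ≤ psum α j
psum-mono α {i} {j} i≤j with m≤n⇒∃[o]m+o≡n i≤j
... | d , refl = go d
  where
  go : ∀ d → psum α i ≤ psum α (i + d)
  go zero    = ≤-reflexive (cong (psum α) (sym (+-identityʳ i)))
  go (suc d) = ≤-trans (go d) (≤-trans (m≤m+n _ (α (i + d))) (≤-reflexive (cong (psum α) (sym (+-suc i d)))))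

-- `psum α k ∸ psum α j` counts the residues greater than j, so this is the sum of the conjugate.
-- The zero term at j = k makes the range agree with the m columns of `base`.
residues-sum : ∀ α k → sum (residues α k) ≡ sum (applyUpTo (λ j → psum α k ∸ psum α j) (suc k))
residues-sum α zero    = refl
residues-sum α (suc k) = begin
  sum (replicate (α k) (suc k) ++ residues α k)
    ≡⟨ sum-++ (replicate (α k) (suc k)) (residues α k) ⟩
  sum (replicate (α k) (suc k)) + sum (residues α k)
    ≡⟨ cong₂ _+_ (trans (sum-replicate (α k) (suc k)) (trans (*-comm (α k) (suc k))
         (sym (sum-applyUpTo-const (α k) (suc k))))) (residues-sum α k) ⟩
  sum (applyUpTo (λ _ → α k) (suc k)) + sum (applyUpTo (λ j → psum α k ∸ psum α j) (suc k))
    ≡⟨ sym (sum-applyUpTo-+ (λ _ → α k) (λ j → psum α k ∸ psum α j) (suc k)) ⟩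
  sum (applyUpTo (λ j → α k + (psum α k ∸ psum α j)) (suc k))
    ≡⟨ cong sum (applyUpTo-cong (suc k) λ j j≤k → trans (+-comm (α k) _) (sym (+-∸-comm (α k) (psum-mono α (s≤s⁻¹ j≤k))))) ⟩
  sum (applyUpTo g (suc k))
    ≡⟨ sym (+-identityʳ _) ⟩
  sum (applyUpTo g (suc k)) + 0
    ≡⟨ cong (sum (applyUpTo g (suc k)) +_) (sym (n∸n≡0 (psum α (suc k)))) ⟩
  sum (applyUpTo g (suc k)) + g (suc k)
    ≡⟨ sym (sum-applyUpTo-suc g (suc k)) ⟩
  sum (applyUpTo g (suc (suc k))) ∎
  where open ≡-Reasoning
        g = λ j → psum α (suc k) ∸ psum α j

tally : ℕ → List ℕ → ℕ
tally i = countᵇ (_≡ᵇ i)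

tally-≡ : ∀ i xs → tally i (i ∷ xs) ≡ suc (tally i xs)
tally-≡ i xs with i ≡ᵇ i | ≡⇒≡ᵇ i i refl
... | true | _ = refl

tally-≢ : ∀ {i x} xs → x ≢ i → tally i (x ∷ xs) ≡ tally i xs
tally-≢ {i} {x} xs x≢i with x ≡ᵇ i | ≡ᵇ⇒≡ x i
... | true  | f = contradiction (f _) x≢i
... | false | _ = refl

tally-absent : ∀ {i} xs → All (_≢ i) xs → tally i xs ≡ 0
tally-absent []       []       = refl
tally-absent (x ∷ xs) (p ∷ ps) = trans (tally-≢ xs p) (tally-absent xs ps)

tally-replicate : ∀ c x {i} ys → x ≢ i → tally i (replicate c x ++ ys) ≡ tally i ys
tally-replicate zero    x ys p = refl
tally-replicate (suc c) x ys p = trans (tally-≢ (replicate c x ++ ys) p) (tally-replicate c x ys p)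

tally-replicate-≡ : ∀ c i ys → tally i (replicate c i ++ ys) ≡ c + tally i ys
tally-replicate-≡ zero    i ys = refl
tally-replicate-≡ (suc c) i ys = trans (tally-≡ i (replicate c i ++ ys)) (cong suc (tally-replicate-≡ c i ys))

residues-tally : ∀ α k j → j < k → tally (suc j) (residues α k) ≡ α j
residues-tally α (suc k) j (s≤s j≤k) with m≤n⇒m<n∨m≡n j≤k
... | inj₁ j<k  = trans (tally-replicate (α k) (suc k) (residues α k) (λ q → <⇒≢ j<k (sym (suc-injective q)))) (residues-tally α k j j<k)
... | inj₂ refl = trans (tally-replicate-≡ (α k) (suc k) (residues α k))
    (trans (cong (α k +_) (tally-absent (residues α k) (All.map (λ (_ , q) → <⇒≢ (s≤s q)) (residues-range α k)))) (+-identityʳ (α k)))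

split-top : ∀ k xs → AllPairs _≥_ xs → All (λ r → 0 < r × r ≤ suc k) xs →
  ∃ λ ys → xs ≡ replicate (tally (suc k) xs) (suc k) ++ ys × AllPairs _≥_ ys × All (λ r → 0 < r × r ≤ k) ys
split-top k [] s b = [] , refl , [] , []
split-top k (x ∷ xs) (x≥ ∷ s) ((0<x , x≤) ∷ b) with m≤n⇒m<n∨m≡n x≤
... | inj₁ x<k rewrite tally-absent {suc k} (x ∷ xs) (<⇒≢ x<k ∷ All.map (λ q → <⇒≢ (≤-<-trans q x<k)) x≥) =
  x ∷ xs , refl , x≥ ∷ s , (0<x , s≤s⁻¹ x<k) ∷ All.zipWith (λ ((p , _) , q) → p , ≤-trans q (s≤s⁻¹ x<k)) (b , x≥)
... | inj₂ refl rewrite tally-≡ (suc k) xs with split-top k xs s b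
...   | ys , q , s′ , b′ = ys , cong (suc k ∷_) q , s′ , b′

-- A sorted list is determined by its multiplicities, so the residues of λ in O carry no information
-- beyond the ℓ_j.
residues-unique : ∀ α k xs → AllPairs _≥_ xs → All (λ r → 0 < r × r ≤ k) xs →
  (∀ j → j < k → tally (suc j) xs ≡ α j) → xs ≡ residues α k
residues-unique α zero    []       s b h = refl
residues-unique α zero    (x ∷ xs) s ((p , q) ∷ b) h = contradiction (≤-trans p q) λ ()
residues-unique α (suc k) xs s b h with split-top k xs s b
... | ys , q , s′ , b′ = trans q (cong₂ (λ c zs → replicate c (suc k) ++ zs) (h k ≤-refl)
    (residues-unique α k ys s′ b′ λ j j<k →
      trans (sym (tally-replicate (tally (suc k) xs) (suc k) ys (λ e → <⇒≢ j<k (sym (suc-injective e)))))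
      (trans (cong (tally (suc j)) (sym q)) (h j (m≤n⇒m≤1+n j<k)))))

-- Coding the partitions in O by quotients

module OSide (M′ : ℕ) where

  open Conditions M′
  open Modulus M
  open LSide M′

  quot rem : List ℕ → List ℕ
  quot = map (_/ m)
  rem  = map (_% m)

  glue : List ℕ → List ℕ → List ℕ
  glue = zipWith (λ x r → r + x * m)

  glue-quot-rem : ∀ μ → glue (quot μ) (rem μ) ≡ μ
  glue-quot-rem []      = refl
  glue-quot-rem (x ∷ μ) = cong₂ _∷_ (sym (m≡m%n+[m/n]*n x m)) (glue-quot-rem μ)

  quot-glue : ∀ xs rs → length xs ≡ length rs → All (_< m) rs → quot (glue xs rs) ≡ xs
  quot-glue []       []       q b        = refl
  quot-glue (x ∷ xs) (r ∷ rs) q (p ∷ ps) = cong₂ _∷_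
    (*-cancelʳ-≡ _ x m (+-cancelˡ-≡ r _ _ (trans (cong (_+ (r + x * m) / m * m) (sym rem≡)) (sym (m≡m%n+[m/n]*n (r + x * m) m)))))
    (quot-glue xs rs (suc-injective q) ps)
    where rem≡ : (r + x * m) % m ≡ r
          rem≡ = trans ([m+kn]%n≡m%n r x m) (m<n⇒m%n≡m p)

  rem-glue : ∀ xs rs → length xs ≡ length rs → All (_< m) rs → rem (glue xs rs) ≡ rs
  rem-glue []       []       q b        = refl
  rem-glue (x ∷ xs) (r ∷ rs) q (p ∷ ps) =
    cong₂ _∷_ (trans ([m+kn]%n≡m%n r x m) (m<n⇒m%n≡m p)) (rem-glue xs rs (suc-injective q) ps)

  at-glue : ∀ xs rs → length xs ≡ length rs → ∀ j → at (glue xs rs) j ≡ at rs j + at xs j * m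
  at-glue []       []       q j       = refl
  at-glue (x ∷ xs) (r ∷ rs) q zero    = refl
  at-glue (x ∷ xs) (r ∷ rs) q (suc j) = at-glue xs rs (suc-injective q) j

  at-quot : ∀ μ j → at (quot μ) j ≡ at μ j / m
  at-quot []      j       = refl
  at-quot (x ∷ μ) zero    = refl
  at-quot (x ∷ μ) (suc j) = at-quot μ j

  sum-quot-rem : ∀ μ → m * sum (quot μ) + sum (rem μ) ≡ sum μ
  sum-quot-rem [] = cong (_+ 0) (*-zeroʳ m)
  sum-quot-rem (x ∷ μ) = trans (eq m (x / m) (sum (quot μ)) (x % m) (sum (rem μ)))
      (cong₂ _+_ (sym (m≡m%n+[m/n]*n x m)) (sum-quot-rem μ))
    where eq : ∀ m a b c d → m * (a + b) + (c + d) ≡ (c + a * m) + (m * b + d)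
          eq = solve-∀

  glue-positive : ∀ xs {rs} → All (0 <_) rs → Positive (glue xs rs)
  glue-positive []       p        = []
  glue-positive (x ∷ xs) []       = []
  glue-positive (x ∷ xs) (p ∷ ps) = ≤-trans p (m≤m+n _ _) ∷ glue-positive xs ps

  glue-< : ∀ {n xs rs} → All (_< n) xs → All (_< m) rs → All (_< n * m) (glue xs rs)
  glue-< []       _        = []
  glue-< (p ∷ ps) []       = []
  glue-< {n} {x ∷ xs} (p ∷ ps) (q ∷ qs) = <-≤-trans (+-monoˡ-< (x * m) q) (*-monoˡ-≤ m p) ∷ glue-< ps qs

  Layered : ℕ → (ℕ → ℕ) → List ℕ → Set
  Layered n α μ = rem μ ≡ residues α M × All (_< n * m) μ

  ℓ-tally : ∀ i μ → ℓ m i μ ≡ tally i (rem μ)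
  ℓ-tally i μ = cong sum (map-∘ μ)

  inO⇒layered : ∀ n μ (a : Vec ℕ M) → Mono (at μ) → 1 ≤ n → T (inO m n μ ∧ eqVecᵇ (ℓVec m μ) a) →
    Layered n (at (toList a)) μ
  inO⇒layered n μ a h 1≤n t with ∧-split {inO m n μ} t
  ... | t₁ , t₂ with ∧-split {allᵇ (λ x → not ((x % m) ≡ᵇ 0)) μ} t₁
  ... | t₃ , t₄ with ∧-split {nonincr (rem μ)} t₄
  ... | t₅ , t₆ =
      residues-unique (at (toList a)) M (rem μ) (mono⇒desc (rem μ) (nonincr⇒mono (rem μ) t₅))
        (All.map⁺ (All.map (λ {x} p → nonzero x p , s≤s⁻¹ (m%n<n x m)) (allᵇ⁻ _ μ t₃)))
        (λ j p → trans (sym (ℓ-tally (suc j) μ)) (eqVecᵇ⁻ (λ i → ℓ m (suc i) μ) a t₂ j p))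
    , at-all μ (λ j → ≤-<-trans (mono-≤ h {0} {j} z≤n)
        (subst (_< n * m) (part-at μ 0) (<ᵇ⇒< (part μ 1) (n * m) t₆)))
    where
    nonzero : ∀ x → T (not ((x % m) ≡ᵇ 0)) → 0 < x % m
    nonzero x t with x % m
    ... | suc r = s≤s z≤n

  layered⇒inO : ∀ n μ (a : Vec ℕ M) → 1 ≤ n → Layered n (at (toList a)) μ →
    T (inO m n μ ∧ eqVecᵇ (ℓVec m μ) a)
  layered⇒inO n μ a 1≤n (r , b) = ∧-join
    (∧-join (allᵇ⁺ _ (All.map (λ {x} (p , _) → nonzero x p) (All.map⁻ (subst (All _) (sym r) (residues-range α M)))))
      (∧-join (mono⇒nonincr (rem μ) (desc⇒mono (subst (AllPairs _≥_) (sym r) (residues-desc α M))))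
        (<⇒<ᵇ (subst (_< n * m) (sym (part-at μ 0)) (head-< μ b)))))
    (eqVecᵇ⁺ (λ i → ℓ m (suc i) μ) a λ j p → trans (ℓ-tally (suc j) μ) (trans (cong (tally (suc j)) r) (residues-tally α M j p)))
    where
    α = at (toList a)
    nonzero : ∀ x → 0 < x % m → T (not ((x % m) ≡ᵇ 0))
    nonzero x p with x % m
    ... | suc r = _
    head-< : ∀ μ → All (_< n * m) μ → at μ 0 < n * m
    -- The empty partition has λ_1 = 0, and 0 < n * m rests on n ≥ 1.
    head-< []      _       = ≤-trans 1≤n (m≤m*n n m)
    head-< (x ∷ μ) (p ∷ _) = p

  OParts : ℕ → (ℕ → ℕ) → ℕ → List ℕ → Set
  OParts n α N μ = (Mono (at μ) × Positive μ × sum μ ≡ N) × Layered n α μ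

  Quotients : ℕ → (ℕ → ℕ) → ℕ → List ℕ → Set
  Quotients n α N xs = Sorted< n xs × length xs ≡ psum α M × m * sum xs + base α ≡ N

  -- Since the residues are nonincreasing, any nonincreasing list of quotients glues to a
  -- nonincreasing list. Reversal gives the ascending order that `peel` expects.
  OParts≃Quotients : ∀ n α N → OParts n α N ≃ Quotients n α N
  OParts≃Quotients n α N = record
    { to      = λ μ → reverse (quot μ)
    ; from    = λ xs → glue (reverse xs) (residues α M)
    ; to-∈    = to-∈
    ; from-∈  = from-∈
    ; from∘to = λ { {μ} (_ , r , _) → trans (cong₂ glue (reverse-involutive (quot μ)) (sym r)) (glue-quot-rem μ) }
    ; to∘from = λ { {xs} (_ , l , _) →
                    trans (cong reverse (quot-glue (reverse xs) (residues α M) (lengths xs l) residues<)) (reverse-involutive xs) }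
    }
    where
    residues< : All (_< m) (residues α M)
    residues< = All.map (λ (_ , q) → s≤s q) (residues-range α M)
    lengths : ∀ xs → length xs ≡ psum α M → length (reverse xs) ≡ length (residues α M)
    lengths xs l = trans (length-reverse xs) (trans l (sym (residues-length α M)))
    to-∈ : ∀ {μ} → OParts n α N μ → Quotients n α N (reverse (quot μ))
    to-∈ {μ} ((h , _ , w) , r , b) =
        ( AllPairs-reverse (mono⇒desc (quot μ) λ j → subst₂ _≤_ (sym (at-quot μ (suc j))) (sym (at-quot μ j)) (/-monoˡ-≤ m (h j)))
        , all-reverse (quot μ) (All.map⁺ (All.map m<n*o⇒m/o<n b)))
      , trans (length-reverse (quot μ)) (trans (trans (length-map _ μ) (sym (length-map _ μ))) (trans (cong length r) (residues-length α M)))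
      , trans (cong₂ (λ x y → m * x + y) (sum-reverse (quot μ)) (trans (sym (residues-sum α M)) (cong sum (sym r))))
          (trans (sum-quot-rem μ) w)
    from-∈ : ∀ {xs} → Quotients n α N xs → OParts n α N (glue (reverse xs) (residues α M))
    from-∈ {xs} ((s , b) , l , w) =
        ( (λ j → subst₂ _≤_ (sym (at-glue ys rs L (suc j))) (sym (at-glue ys rs L j))
             (+-mono-≤ (desc⇒mono (residues-desc α M) j) (*-monoˡ-≤ m (desc⇒mono (AllPairs-reverse s) j))))
        , glue-positive ys (All.map proj₁ (residues-range α M))
        , trans (sym (sum-quot-rem (glue ys rs)))
            (trans (cong₂ (λ x y → m * sum x + sum y) (quot-glue ys rs L residues<) (rem-glue ys rs L residues<))
            (trans (cong₂ (λ x y → m * x + y) (sum-reverse xs) (residues-sum α M)) w)))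
      , rem-glue ys rs L residues<
      , glue-< (all-reverse xs b) residues<
      where
      ys = reverse xs
      rs = residues α M
      L = lengths xs l

  -- `sumD` turns into the number of quotients and `sumY` into their sum; as `base α` is common to
  -- both sides, the weight is preserved.
  Halls≃Quotients : ∀ n α N → Halls n α N ≃ Quotients n α N
  Halls≃Quotients n α N = record
    { to      = fromBlocks n
    ; from    = toBlocks n
    ; to-∈    = λ { {bs} (L , d , w) → let (S , q) = fromBlocks-spec L in
                    S , trans (sym (toBlocks-sumD n S)) (trans (cong sumD q) d)
                      , trans (cong (λ x → m * x + base α) (trans (sym (toBlocks-sumY n S)) (cong sumY q))) w }
    ; from-∈  = λ (S , l , w) → toBlocks-lectureHall n S , trans (toBlocks-sumD n S) l
                      , trans (cong (λ x → m * x + base α) (toBlocks-sumY n S)) w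
    ; from∘to = λ (L , _ , _) → proj₂ (fromBlocks-spec L)
    ; to∘from = λ (S , _ , _) → fromBlocks∘toBlocks n S
    }

-- Counting

≃-trans : ∀ {A B C : Set} {P : A → Set} {Q : B → Set} {R : C → Set} → P ≃ Q → Q ≃ R → P ≃ R
≃-trans f g = record
  { to      = G.to ∘ F.to
  ; from    = F.from ∘ G.from
  ; to-∈    = G.to-∈ ∘ F.to-∈
  ; from-∈  = F.from-∈ ∘ G.from-∈
  ; from∘to = λ p → trans (cong F.from (G.from∘to (F.to-∈ p))) (F.from∘to p)
  ; to∘from = λ r → trans (cong G.to (F.to∘from (G.from-∈ r))) (G.to∘from r)
  }
  where module F = _≃_ f
        module G = _≃_ g

≃-sym : ∀ {A B : Set} {P : A → Set} {Q : B → Set} → P ≃ Q → Q ≃ P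
≃-sym f = record
  { to = F.from ; from = F.to ; to-∈ = F.from-∈ ; from-∈ = F.to-∈ ; from∘to = F.to∘from ; to∘from = F.from∘to }
  where module F = _≃_ f

≃-resp : ∀ {A B : Set} {P P′ : A → Set} {Q Q′ : B → Set} →
  (∀ x → P x ⇔ P′ x) → (∀ y → Q y ⇔ Q′ y) → P′ ≃ Q′ → P ≃ Q
≃-resp p q f = record
  { to      = F.to
  ; from    = F.from
  ; to-∈    = Equivalence.from (q _) ∘ F.to-∈ ∘ Equivalence.to (p _)
  ; from-∈  = Equivalence.from (p _) ∘ F.from-∈ ∘ Equivalence.to (q _)
  ; from∘to = F.from∘to ∘ Equivalence.to (p _)
  ; to∘from = F.to∘from ∘ Equivalence.to (q _)
  }
  where module F = _≃_ f

map-unique : ∀ {A B : Set} (f : A → B) (g : B → A) {xs} → All (λ x → g (f x) ≡ x) xs → Unique xs → Unique (map f xs)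
map-unique f g []       []       = []
map-unique f g (q ∷ qs) (d ∷ ds) =
  All.map⁺ (All.zipWith (λ (x≢y , r) e → x≢y (trans (sym q) (trans (cong g e) r))) (d , qs)) ∷ map-unique f g qs ds

-- The image of xs is free of repetitions and has the same members as ys, so the two lists are
-- permutations of each other.
≃-length : ∀ {A B : Set} {xs : List A} {ys : List B} → Unique xs → Unique ys → (_∈ xs) ≃ (_∈ ys) → length xs ≡ length ys
≃-length {xs = xs} {ys} u v f = trans (sym (length-map F.to xs)) (↭-length (∼bag⇒↭ (unique∧set⇒bag
    (map-unique F.to F.from (All.tabulate F.from∘to) u) v
    (mk⇔ (λ p → let (x , x∈ , q) = ∈-map⁻ F.to p in subst (_∈ ys) (sym q) (F.to-∈ x∈))
         (λ q → subst (_∈ map F.to xs) (F.to∘from q) (∈-map⁺ F.to (F.from-∈ q)))))))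
  where module F = _≃_ f

countᵇ-filterᵇ : ∀ {A : Set} (p : A → Bool) xs → countᵇ p xs ≡ length (filterᵇ p xs)
countᵇ-filterᵇ p []       = refl
countᵇ-filterᵇ p (x ∷ xs) with p x
... | true  = cong suc (countᵇ-filterᵇ p xs)
... | false = countᵇ-filterᵇ p xs

lists-suc : ∀ L N → lists (suc L) N ≡ [] ∷ cartesianProductWith _∷_ (applyUpTo suc N) (lists L N)
lists-suc L N = cong ([] ∷_) (go (applyUpTo suc N))
  where
  go : ∀ xs → concatMap (λ x → map (x ∷_) (lists L N)) xs ≡ cartesianProductWith _∷_ xs (lists L N)
  go []       = refl
  go (x ∷ xs) = cong (map (x ∷_) (lists L N) ++_) (go xs)

lists-unique : ∀ L N → Unique (lists L N)
lists-unique zero    N = [] ∷ []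
lists-unique (suc L) N = subst Unique (sym (lists-suc L N))
  ( All.tabulate (λ p q → nil-absent (subst (_∈ cartesianProductWith _∷_ (applyUpTo suc N) (lists L N)) (sym q) p))
  ∷ Unique.cartesianProductWith⁺ _∷_ ∷-injective
      (Unique.applyUpTo⁺₁ suc N (λ i<j _ q → <⇒≢ i<j (suc-injective q))) (lists-unique L N))
  where
  nil-absent : ¬ [] ∈ cartesianProductWith _∷_ (applyUpTo suc N) (lists L N)
  nil-absent p with ∈-cartesianProductWith⁻ _∷_ (applyUpTo suc N) (lists L N) p
  ... | _ , _ , _ , _ , ()

lists-positive : ∀ L N {μ} → μ ∈ lists L N → Positive μ
lists-positive zero    N (here refl) = []
lists-positive (suc L) N {μ} p with subst (μ ∈_) (lists-suc L N) p
... | here refl = []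
... | there q with ∈-cartesianProductWith⁻ _∷_ (applyUpTo suc N) (lists L N) q
...   | x , ν , x∈ , ν∈ , refl with ∈-applyUpTo⁻ suc x∈
...     | i , _ , refl = s≤s z≤n ∷ lists-positive L N ν∈

lists-complete : ∀ L N {μ} → Positive μ → sum μ ≤ N → length μ ≤ L → μ ∈ lists L N
lists-complete zero    N {[]}    _ _ _ = here refl
lists-complete (suc L) N {[]}    _ _ _ = here refl
lists-complete (suc L) N {suc x ∷ μ} (p ∷ ps) w (s≤s l) = subst (suc x ∷ μ ∈_) (sym (lists-suc L N))
  (there (∈-cartesianProductWith⁺ _∷_ (∈-applyUpTo⁺ suc (≤-trans (m≤m+n (suc x) (sum μ)) w))
    (lists-complete L N ps (≤-trans (m≤n+m (sum μ) (suc x)) w) l)))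

length≤sum : ∀ {μ} → Positive μ → length μ ≤ sum μ
length≤sum []       = z≤n
length≤sum (p ∷ ps) = +-mono-≤ p (length≤sum ps)

Partition : ℕ → List ℕ → Set
Partition N μ = Mono (at μ) × Positive μ × sum μ ≡ N

∈-partitionsOf : ∀ N μ → μ ∈ partitionsOf N ⇔ Partition N μ
∈-partitionsOf N μ = mk⇔
  (λ p → let (q , t)  = ∈-filter⁻ (T? ∘ good) {xs = lists N N} p
             (h , w) = ∧-split {nonincr μ} t
         in nonincr⇒mono μ h , lists-positive N N q , ≡ᵇ⇒≡ (sum μ) N w)
  (λ { (h , pos , refl) → ∈-filter⁺ (T? ∘ good)
         -- Positive parts with sum N are at most N in number and in size, so `lists N N` contains
         -- the partition.
         (lists-complete N N pos ≤-refl (length≤sum pos))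
         (∧-join (mono⇒nonincr μ h) (≡⇒≡ᵇ (sum μ) N refl)) })
  where good : List ℕ → Bool
        good μ = nonincr μ ∧ (sum μ ≡ᵇ N)

countᵇ-≃ : ∀ N (p q : List ℕ → Bool) →
  (λ μ → Partition N μ × T (p μ)) ≃ (λ μ → Partition N μ × T (q μ)) →
  countᵇ p (partitionsOf N) ≡ countᵇ q (partitionsOf N)
countᵇ-≃ N p q f = trans (countᵇ-filterᵇ p (partitionsOf N)) (trans
    (≃-length (selected-unique p) (selected-unique q) (≃-resp (selected p) (selected q) f))
    (sym (countᵇ-filterᵇ q (partitionsOf N))))
  where
  selected-unique : ∀ p → Unique (filterᵇ p (partitionsOf N))
  selected-unique p = Unique.filter⁺ (T? ∘ p) (Unique.filter⁺ (λ μ → T? (nonincr μ ∧ (sum μ ≡ᵇ N))) (lists-unique N N))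
  selected : ∀ p μ → μ ∈ filterᵇ p (partitionsOf N) ⇔ (Partition N μ × T (p μ))
  selected p μ = mk⇔
    (λ h → let (i , t) = ∈-filter⁻ (T? ∘ p) {xs = partitionsOf N} h in Equivalence.to (∈-partitionsOf N μ) i , t)
    (λ (i , t) → ∈-filter⁺ (T? ∘ p) (Equivalence.from (∈-partitionsOf N μ) i) t)

theorem1p3 : (m n : ℕ) .{{_ : NonZero m}} → 2 ≤ m → 1 ≤ n →
    (N : ℕ) (a : Vec ℕ (m ∸ 1)) → coeffL m n N a ≡ coeffO m n N a
theorem1p3 zero           n ()
theorem1p3 (suc zero)     n (s≤s ())
theorem1p3 (suc (suc M′)) n _ 1≤n N a = countᵇ-≃ N inL×s inO×ℓ
  -- Both sides are reduced to data with the same α and N, and insertion joins lecture hall blocks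
  -- to quotients in the middle.
  (≃-resp inL⇔ inO⇔ (≃-trans (LParts≃Halls n α N) (≃-trans (Halls≃Quotients n α N) (≃-sym (OParts≃Quotients n α N)))))
  where
  open Conditions M′
  open Modulus M
  open LSide M′
  open OSide M′
  α = at (toList a)
  inL×s inO×ℓ : List ℕ → Bool
  inL×s μ = inL m n μ ∧ eqVecᵇ (sVec m μ) a
  inO×ℓ μ = inO m n μ ∧ eqVecᵇ (ℓVec m μ) a
  inL⇔ : ∀ μ → (Partition N μ × T (inL×s μ)) ⇔ LParts n α N μ
  inL⇔ μ = mk⇔ (λ (p , t) → p , inL⇒structured n μ a (proj₁ p) t)
               (λ (p , t) → p , structured⇒inL n μ a (proj₁ p) (proj₁ (proj₂ p)) t)
  inO⇔ : ∀ μ → (Partition N μ × T (inO×ℓ μ)) ⇔ OParts n α N μ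
  inO⇔ μ = mk⇔ (λ (p , t) → p , inO⇒layered n μ a (proj₁ p) 1≤n t)
               (λ (p , t) → p , layered⇒inO n μ a 1≤n t)
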